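{- Any quantum algorithm that solves the Maximal Suffix problem on strings of length $n$ requires $\Omega(\sqrt n)$ quantum queries, and any quantum algorithm that solves the Minimal Suffix problem on strings of length $n$ requires $\Omega(\sqrt n)$ quantum queries.
   Context: Strings are 1-indexed sequences over an integer alphabet $\Sigma=\{1,\dots,|\Sigma|\}$ with $|\Sigma|\le n^{O(1)}$. $\prec$ is the lexicographic order: $s\prec t$ if $s$ is a proper prefix of $t$, or at the first position where they differ $s$ has the smaller character. Maximal Suffix: given $s$, output the position $i\in[1..|s|]$ such that $s[i..|s|]\succ s[j..|s|]$ for all $j\in[1..|s|]\setminus\{i\}$. Minimal Suffix: given $s$, output the position $i\in[1..|s|]$ such that $s[i..|s|]\prec s[j..|s|]$ for all $j\in[1..|s|]\setminus\{i\}$. Quantum query model: the input string $s$ is accessed through a unitary oracle $O_s:|i,b\rangle\mapsto|i,b\oplus s[i]\rangle$ ($\oplus$ is XOR of binary encodings of characters), which can be queried in superposition; between queries the algorithm may apply arbitrary unitaries independent of the input; it must output the correct answer with probability at least $2/3$. Query complexity is the number of oracle calls. -}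

module Defs where

open import Data.Bool.Base using (Bool; true; false; _xor_; if_then_else_)
import Data.Bool.Properties as Bool
open import Data.Fin.Base as Fin using (Fin; toℕ)
import Data.Fin.Properties as Fin
open import Data.Integer.Base as ℤ using (+_)
import Data.Integer.Properties as ℤ
open import Data.List.Base as List using (List; []; _∷_; _++_)
open import Data.List.Relation.Binary.Lex.Strict using (Lex-<)
open import Data.Nat.Base as ℕ using (ℕ; zero; suc; _≡ᵇ_)
open import Data.Nat.DivMod using (_/_; _%_)
open import Data.Nat.Logarithm using (⌊log₂_⌋)
import Data.Nat.Properties as ℕ
open import Data.Nat.Solver using () renaming (module +-*-Solver to ℕSolver)
open import Data.Product.Base using (∃-syntax; _×_; _,_; proj₁; proj₂)
import Data.Product.Properties as Product
open import Data.Rational.Base as ℚ using (ℚ; mkℚ; 0ℚ; 1ℚ; ½; ∣_∣)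
import Data.Rational.Properties as ℚ
open import Data.Rational.Solver using () renaming (module +-*-Solver to ℚSolver)
import Data.Rational.Unnormalised.Base as ℚᵘ
import Data.Rational.Unnormalised.Properties as ℚᵘ
open import Data.Sum.Base using (inj₁; inj₂)
open import Data.Vec.Base as Vec using (Vec; []; _∷_)
import Data.Vec.Properties as Vec
open import Relation.Binary.Definitions using (DecidableEquality)
open import Relation.Binary.PropositionalEquality
open import Relation.Nullary.Decidable using (⌊_⌋; yes; no)
open import Relation.Nullary.Negation using (¬_)

-- A real number is a Cauchy sequence of rationals; equality of reals is _≈ᴿ_.
-- The Cauchy proofs are abstract because no relation on ℝ inspects them and
-- unfolding them is expensive.

IsCauchy : (ℕ → ℚ) → Set
IsCauchy s = ∀ ε → 0ℚ ℚ.< ε → ∃[ N ] ∀ m n → N ℕ.≤ m → N ℕ.≤ n → ∣ s m ℚ.- s n ∣ ℚ.< ε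

record ℝ : Set where
  constructor mkℝ
  field
    seq    : ℕ → ℚ
    cauchy : IsCauchy seq

open ℝ public

infix  4 _≈ᴿ_ _≤ᴿ_
infixl 6 _+ᴿ_
infixl 7 _*ᴿ_

_≈ᴿ_ : ℝ → ℝ → Set
x ≈ᴿ y = ∀ ε → 0ℚ ℚ.< ε → ∃[ N ] ∀ n → N ℕ.≤ n → ∣ seq x n ℚ.- seq y n ∣ ℚ.< ε

_≤ᴿ_ : ℝ → ℝ → Set
x ≤ᴿ y = ∀ ε → 0ℚ ℚ.< ε → ∃[ N ] ∀ n → N ℕ.≤ n → seq x n ℚ.< seq y n ℚ.+ ε

private

  halve-pos : ∀ {ε} → 0ℚ ℚ.< ε → 0ℚ ℚ.< ½ ℚ.* ε
  halve-pos {ε} p = subst (ℚ._< ½ ℚ.* ε) (ℚ.*-zeroʳ ½) (ℚ.*-monoʳ-<-pos ½ p)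

  halves : ∀ ε → ½ ℚ.* ε ℚ.+ ½ ℚ.* ε ≡ ε
  halves ε = trans (sym (ℚ.*-distribʳ-+ ε ½ ½)) (ℚ.*-identityˡ ε)

  ≤-⊔ˡ : ∀ {a b n} → a ℕ.⊔ b ℕ.≤ n → a ℕ.≤ n
  ≤-⊔ˡ {a} {b} = ℕ.≤-trans (ℕ.m≤m⊔n a b)

  ≤-⊔ʳ : ∀ {a b n} → a ℕ.⊔ b ℕ.≤ n → b ℕ.≤ n
  ≤-⊔ʳ {a} {b} = ℕ.≤-trans (ℕ.m≤n⊔m a b)

  ∣∣-< : ∀ {x y ε} → x ℚ.- y ℚ.< ε → y ℚ.- x ℚ.< ε → ∣ x ℚ.- y ∣ ℚ.< ε
  ∣∣-< {x} {y} p q with ℚ.∣p∣≡p∨∣p∣≡-p (x ℚ.- y)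
  ... | inj₁ e = subst (ℚ._< _) (sym e) p
  ... | inj₂ e = subst (ℚ._< _) (sym (trans e eq)) q
    where
    open ℚSolver
    eq : ℚ.- (x ℚ.- y) ≡ y ℚ.- x
    eq = solve 2 (λ x y → :- (x :- y) := y :- x) refl x y

abstract

  const-cauchy : ∀ q → IsCauchy (λ _ → q)
  const-cauchy q ε 0<ε =
    0 , λ _ _ _ _ → subst (λ d → ∣ d ∣ ℚ.< ε) (sym (ℚ.+-inverseʳ q)) 0<ε

fromℚ : ℚ → ℝ
fromℚ q = mkℝ (λ _ → q) (const-cauchy q)

fromℕ : ℕ → ℝ
fromℕ n = fromℚ (+ n ℚ./ 1)

0ᴿ 1ᴿ : ℝ
0ᴿ = fromℚ 0ℚ
1ᴿ = fromℚ 1ℚ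

abstract

  +-cauchy : ∀ x y → IsCauchy (λ n → seq x n ℚ.+ seq y n)
  +-cauchy x y ε 0<ε =
    let (N₁ , p) = cauchy x (½ ℚ.* ε) (halve-pos 0<ε)
        (N₂ , q) = cauchy y (½ ℚ.* ε) (halve-pos 0<ε)
    in N₁ ℕ.⊔ N₂ , λ m n N≤m N≤n → begin-strict
      ∣ (seq x m ℚ.+ seq y m) ℚ.- (seq x n ℚ.+ seq y n) ∣
        ≡⟨ cong ∣_∣ (rearrange (seq x m) (seq y m) (seq x n) (seq y n)) ⟩
      ∣ (seq x m ℚ.- seq x n) ℚ.+ (seq y m ℚ.- seq y n) ∣
        ≤⟨ ℚ.∣p+q∣≤∣p∣+∣q∣ (seq x m ℚ.- seq x n) (seq y m ℚ.- seq y n) ⟩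
      ∣ seq x m ℚ.- seq x n ∣ ℚ.+ ∣ seq y m ℚ.- seq y n ∣
        <⟨ ℚ.+-mono-< (p m n (≤-⊔ˡ {N₁} N≤m) (≤-⊔ˡ {N₁} N≤n))
                      (q m n (≤-⊔ʳ {N₁} N≤m) (≤-⊔ʳ {N₁} N≤n)) ⟩
      ½ ℚ.* ε ℚ.+ ½ ℚ.* ε
        ≡⟨ halves ε ⟩
      ε ∎
    where
    open ℚ.≤-Reasoning
    rearrange : ∀ a b c d → (a ℚ.+ b) ℚ.- (c ℚ.+ d) ≡ (a ℚ.- c) ℚ.+ (b ℚ.- d)
    rearrange = solve 4 (λ a b c d → (a :+ b) :- (c :+ d) := (a :- c) :+ (b :- d)) refl
      where open ℚSolver

_+ᴿ_ : ℝ → ℝ → ℝ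
x +ᴿ y = mkℝ (λ n → seq x n ℚ.+ seq y n) (+-cauchy x y)

abstract

  neg-cauchy : ∀ x → IsCauchy (λ n → ℚ.- seq x n)
  neg-cauchy x ε 0<ε =
    let (N , p) = cauchy x ε 0<ε
    in N , λ m n N≤m N≤n →
      subst (ℚ._< ε) (trans (sym (ℚ.∣-p∣≡∣p∣ (seq x m ℚ.- seq x n)))
                            (cong ∣_∣ (rearrange (seq x m) (seq x n))))
            (p m n N≤m N≤n)
    where
    rearrange : ∀ a b → ℚ.- (a ℚ.- b) ≡ (ℚ.- a) ℚ.- (ℚ.- b)
    rearrange = solve 2 (λ a b → :- (a :- b) := (:- a) :- (:- b)) refl
      where open ℚSolver

-ᴿ_ : ℝ → ℝ
-ᴿ x = mkℝ (λ n → ℚ.- seq x n) (neg-cauchy x)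

private

  eventually-bounded : ∀ x → ∃[ B ] 0ℚ ℚ.< B × ∃[ N ] ∀ n → N ℕ.≤ n → ∣ seq x n ∣ ℚ.< B
  eventually-bounded x =
    let (N , p) = cauchy x 1ℚ (ℚ.positive⁻¹ 1ℚ)
        b       = ∣ seq x N ∣
    in b ℚ.+ 1ℚ
     , ℚ.<-≤-trans (ℚ.positive⁻¹ 1ℚ)
         (subst (ℚ._≤ b ℚ.+ 1ℚ) (ℚ.+-identityˡ 1ℚ) (ℚ.+-monoˡ-≤ 1ℚ (ℚ.0≤∣p∣ (seq x N))))
     , N , λ n N≤n → begin-strict
         ∣ seq x n ∣
           ≡⟨ cong ∣_∣ (rearrange (seq x n) (seq x N)) ⟩
         ∣ seq x N ℚ.+ (seq x n ℚ.- seq x N) ∣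
           ≤⟨ ℚ.∣p+q∣≤∣p∣+∣q∣ (seq x N) (seq x n ℚ.- seq x N) ⟩
         b ℚ.+ ∣ seq x n ℚ.- seq x N ∣
           <⟨ ℚ.+-monoʳ-< b (p n N N≤n ℕ.≤-refl) ⟩
         b ℚ.+ 1ℚ ∎
    where
    open ℚ.≤-Reasoning
    rearrange : ∀ a c → a ≡ c ℚ.+ (a ℚ.- c)
    rearrange = solve 2 (λ a c → a := c :+ (a :- c)) refl
      where open ℚSolver

  divide : ∀ D ε → 0ℚ ℚ.< D → 0ℚ ℚ.< ε → ∃[ δ ] 0ℚ ℚ.< δ × D ℚ.* δ ≡ ε
  divide D ε 0<D 0<ε = D⁻¹ ℚ.* ε
    , subst (ℚ._< D⁻¹ ℚ.* ε) (ℚ.*-zeroʳ D⁻¹)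
        (ℚ.*-monoʳ-<-pos D⁻¹ {{ℚ.1/pos⇒pos D {{ℚ.positive 0<D}}}} 0<ε)
    , trans (sym (ℚ.*-assoc D D⁻¹ ε))
        (trans (cong (ℚ._* ε) (ℚ.*-inverseʳ D {{ℚ.>-nonZero 0<D}})) (ℚ.*-identityˡ ε))
    where
    D⁻¹ = ℚ.1/_ D {{ℚ.>-nonZero 0<D}}

  *-close : ∀ a b c d {B C δ} → 0ℚ ℚ.< B → 0ℚ ℚ.< C → ∣ a ∣ ℚ.< B → ∣ d ∣ ℚ.< C →
            ∣ a ℚ.- c ∣ ℚ.< δ → ∣ b ℚ.- d ∣ ℚ.< δ →
            ∣ a ℚ.* b ℚ.- c ℚ.* d ∣ ℚ.< (B ℚ.+ C) ℚ.* δ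
  *-close a b c d {B} {C} {δ} 0<B 0<C a<B d<C ac<δ bd<δ = begin-strict
    ∣ a ℚ.* b ℚ.- c ℚ.* d ∣
      ≡⟨ cong ∣_∣ (telescope (a ℚ.* b) (a ℚ.* d) (c ℚ.* d)) ⟩
    ∣ (a ℚ.* b ℚ.- a ℚ.* d) ℚ.+ (a ℚ.* d ℚ.- c ℚ.* d) ∣
      ≤⟨ ℚ.∣p+q∣≤∣p∣+∣q∣ (a ℚ.* b ℚ.- a ℚ.* d) (a ℚ.* d ℚ.- c ℚ.* d) ⟩
    ∣ a ℚ.* b ℚ.- a ℚ.* d ∣ ℚ.+ ∣ a ℚ.* d ℚ.- c ℚ.* d ∣
      ≡⟨ cong₂ (λ p q → ∣ p ∣ ℚ.+ ∣ q ∣) left right ⟩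
    ∣ a ℚ.* (b ℚ.- d) ∣ ℚ.+ ∣ d ℚ.* (a ℚ.- c) ∣
      <⟨ ℚ.+-mono-< (prod a (b ℚ.- d) 0<B a<B bd<δ) (prod d (a ℚ.- c) 0<C d<C ac<δ) ⟩
    B ℚ.* δ ℚ.+ C ℚ.* δ
      ≡⟨ ℚ.*-distribʳ-+ δ B C ⟨
    (B ℚ.+ C) ℚ.* δ ∎
    where
    open ℚ.≤-Reasoning

    telescope : ∀ x y z → x ℚ.- z ≡ (x ℚ.- y) ℚ.+ (y ℚ.- z)
    telescope = solve 3 (λ x y z → x :- z := (x :- y) :+ (y :- z)) refl
      where open ℚSolver

    left : a ℚ.* b ℚ.- a ℚ.* d ≡ a ℚ.* (b ℚ.- d)
    left = trans (cong (a ℚ.* b ℚ.+_) (ℚ.neg-distribʳ-* a d))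
                 (sym (ℚ.*-distribˡ-+ a b (ℚ.- d)))

    right : a ℚ.* d ℚ.- c ℚ.* d ≡ d ℚ.* (a ℚ.- c)
    right = trans (cong (a ℚ.* d ℚ.+_) (ℚ.neg-distribˡ-* c d))
              (trans (sym (ℚ.*-distribʳ-+ d a (ℚ.- c))) (ℚ.*-comm (a ℚ.- c) d))

    prod : ∀ x y {A} → 0ℚ ℚ.< A → ∣ x ∣ ℚ.< A → ∣ y ∣ ℚ.< δ → ∣ x ℚ.* y ∣ ℚ.< A ℚ.* δ
    prod x y {A} 0<A x<A y<δ = begin-strict
      ∣ x ℚ.* y ∣      ≡⟨ ℚ.∣p*q∣≡∣p∣*∣q∣ x y ⟩
      ∣ x ∣ ℚ.* ∣ y ∣  ≤⟨ ℚ.*-monoʳ-≤-nonNeg ∣ y ∣ {{ℚ.∣-∣-nonNeg y}} (ℚ.<⇒≤ x<A) ⟩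
      A ℚ.* ∣ y ∣      <⟨ ℚ.*-monoʳ-<-pos A {{ℚ.positive 0<A}} y<δ ⟩
      A ℚ.* δ          ∎

abstract

  *-cauchy : ∀ x y → IsCauchy (λ n → seq x n ℚ.* seq y n)
  *-cauchy x y ε 0<ε =
    let (B , 0<B , N₁ , p) = eventually-bounded x
        (C , 0<C , N₂ , q) = eventually-bounded y
        (δ , 0<δ , B+C*δ≡ε) = divide (B ℚ.+ C) ε (ℚ.+-mono-< 0<B 0<C) 0<ε
        (N₃ , r) = cauchy x δ 0<δ
        (N₄ , s) = cauchy y δ 0<δ
        M = N₁ ℕ.⊔ N₂
    in M ℕ.⊔ (N₃ ℕ.⊔ N₄) , λ m n N≤m N≤n →
       subst (_ ℚ.<_) B+C*δ≡ε
         (*-close (seq x m) (seq y m) (seq x n) (seq y n) 0<B 0<C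
           (p m (≤-⊔ˡ {N₁} (≤-⊔ˡ {M} N≤m)))
           (q n (≤-⊔ʳ {N₁} (≤-⊔ˡ {M} N≤n)))
           (r m n (≤-⊔ˡ {N₃} (≤-⊔ʳ {M} N≤m)) (≤-⊔ˡ {N₃} (≤-⊔ʳ {M} N≤n)))
           (s m n (≤-⊔ʳ {N₃} (≤-⊔ʳ {M} N≤m)) (≤-⊔ʳ {N₃} (≤-⊔ʳ {M} N≤n))))

_*ᴿ_ : ℝ → ℝ → ℝ
x *ᴿ y = mkℝ (λ n → seq x n ℚ.* seq y n) (*-cauchy x y)

-- isqrt n = ⌊√n⌋

isqrt : ℕ → ℕ
isqrt zero    = 0
isqrt (suc n) with suc (isqrt n) ℕ.* suc (isqrt n) ℕ.≤? suc n
... | yes _ = suc (isqrt n)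
... | no  _ = isqrt n

isqrt-lower : ∀ n → isqrt n ℕ.* isqrt n ℕ.≤ n
isqrt-lower zero = ℕ.z≤n
isqrt-lower (suc n) with suc (isqrt n) ℕ.* suc (isqrt n) ℕ.≤? suc n
... | yes p = p
... | no  _ = ℕ.m≤n⇒m≤1+n (isqrt-lower n)

isqrt-upper : ∀ n → n ℕ.< suc (isqrt n) ℕ.* suc (isqrt n)
isqrt-upper zero = ℕ.s≤s ℕ.z≤n
isqrt-upper (suc n) with suc (isqrt n) ℕ.* suc (isqrt n) ℕ.≤? suc n
... | yes p = ℕ.≤-<-trans (isqrt-upper n) (ℕ.*-mono-< n<1+r n<1+r)
  where
  n<1+r = ℕ.n<1+n (suc (isqrt n))
... | no ¬p = ℕ.≰⇒> ¬p

private

  frac-< : ∀ {a b} m k → a ℕ.* suc k ℕ.< b ℕ.* suc m → (+ a ℚ./ suc m) ℚ.< (+ b ℚ./ suc k)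
  frac-< {a} {b} m k p = ℚ.toℚᵘ-cancel-<
    (ℚᵘ.<-respˡ-≃ (ℚᵘ.≃-sym (ℚ.toℚᵘ-fromℚᵘ (ℚᵘ.mkℚᵘ (+ a) m)))
      (ℚᵘ.<-respʳ-≃ (ℚᵘ.≃-sym (ℚ.toℚᵘ-fromℚᵘ (ℚᵘ.mkℚᵘ (+ b) k)))
        (ℚᵘ.*<* (subst₂ ℤ._<_ (ℤ.pos-* a (suc k)) (ℤ.pos-* b (suc m)) (ℤ.+<+ p)))))

  frac-suc : ∀ b k → (+ suc b ℚ./ suc k) ≡ (+ b ℚ./ suc k) ℚ.+ (+ 1 ℚ./ suc k)
  frac-suc b k = ℚ.toℚᵘ-injective (ℚᵘ.≃-trans (ℚ.toℚᵘ-fromℚᵘ (ℚᵘ.mkℚᵘ (+ suc b) k))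
    (ℚᵘ.≃-trans lem (ℚᵘ.≃-sym
      (ℚᵘ.≃-trans (ℚ.toℚᵘ-homo-+ (+ b ℚ./ suc k) (+ 1 ℚ./ suc k))
        (ℚᵘ.+-cong (ℚ.toℚᵘ-fromℚᵘ (ℚᵘ.mkℚᵘ (+ b) k)) (ℚ.toℚᵘ-fromℚᵘ (ℚᵘ.mkℚᵘ (+ 1) k)))))))
    where
    lem : ℚᵘ.mkℚᵘ (+ suc b) k ℚᵘ.≃ ℚᵘ.mkℚᵘ (+ b) k ℚᵘ.+ ℚᵘ.mkℚᵘ (+ 1) k
    lem = ℚᵘ.*≡* (begin
      + suc b ℤ.* (+ (suc k ℕ.* suc k))
        ≡⟨ ℤ.pos-* (suc b) (suc k ℕ.* suc k) ⟨
      + (suc b ℕ.* (suc k ℕ.* suc k))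
        ≡⟨ cong +_ (arith b (suc k)) ⟩
      + ((b ℕ.* suc k ℕ.+ 1 ℕ.* suc k) ℕ.* suc k)
        ≡⟨ ℤ.pos-* (b ℕ.* suc k ℕ.+ 1 ℕ.* suc k) (suc k) ⟩
      + (b ℕ.* suc k ℕ.+ 1 ℕ.* suc k) ℤ.* + suc k
        ≡⟨ cong (ℤ._* + suc k) (trans (ℤ.pos-+ (b ℕ.* suc k) (1 ℕ.* suc k))
             (cong₂ ℤ._+_ (ℤ.pos-* b (suc k)) (ℤ.pos-* 1 (suc k)))) ⟩
      (+ b ℤ.* + suc k ℤ.+ + 1 ℤ.* + suc k) ℤ.* + suc k ∎)
      where
      open ≡-Reasoning
      open ℕSolver
      arith : ∀ b k → suc b ℕ.* (k ℕ.* k) ≡ (b ℕ.* k ℕ.+ 1 ℕ.* k) ℕ.* k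
      arith = solve 2 (λ b k → (con 1 :+ b) :* (k :* k) := (b :* k :+ con 1 :* k) :* k) refl

  1/suc-< : ∀ ε → 0ℚ ℚ.< ε → ∀ k → ℚ.↧ₙ ε ℕ.≤ k → (+ 1 ℚ./ suc k) ℚ.< ε
  1/suc-< (mkℚ (+ suc p) d c) _ k d≤k = subst ((+ 1 ℚ./ suc k) ℚ.<_)
    (ℚ.fromℚᵘ-toℚᵘ (mkℚ (+ suc p) d c))
    (frac-< {1} {suc p} k d (begin-strict
      1 ℕ.* suc d      ≡⟨ ℕ.*-identityˡ (suc d) ⟩
      suc d            <⟨ ℕ.s≤s d≤k ⟩
      suc k            ≤⟨ ℕ.m≤m+n (suc k) (p ℕ.* suc k) ⟩
      suc p ℕ.* suc k  ∎))
    where open ℕ.≤-Reasoning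
  1/suc-< (mkℚ (+ zero) d c) (ℚ.*<* (ℤ.+<+ ()))
  1/suc-< (mkℚ (ℤ.-[1+_] p) d c) (ℚ.*<* ())

-- The k-th approximation of √n is ⌊√(n (k+1)²)⌋ / (k+1).

√-seq : ℕ → ℕ → ℚ
√-seq n k = + isqrt (n ℕ.* (suc k ℕ.* suc k)) ℚ./ suc k

abstract

  √-cauchy : ∀ n → IsCauchy (√-seq n)
  √-cauchy n ε 0<ε = ℚ.↧ₙ ε , λ m k N≤m N≤k →
    ∣∣-< {√-seq n m} {√-seq n k} (close ε 0<ε m k N≤k) (close ε 0<ε k m N≤m)
    where
    a : ℕ → ℕ
    a k = isqrt (n ℕ.* (suc k ℕ.* suc k))

    sq-cancel-< : ∀ x y → x ℕ.* x ℕ.< y ℕ.* y → x ℕ.< y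
    sq-cancel-< x y p = ℕ.≰⇒> λ y≤x → ℕ.<⇒≱ p (ℕ.*-mono-≤ y≤x y≤x)

    swap : ∀ x y → (x ℕ.* y) ℕ.* (x ℕ.* y) ≡ (x ℕ.* x) ℕ.* (y ℕ.* y)
    swap = solve 2 (λ x y → (x :* y) :* (x :* y) := (x :* x) :* (y :* y)) refl
      where open ℕSolver

    swap₂ : ∀ x y z → (x ℕ.* y) ℕ.* z ≡ (x ℕ.* z) ℕ.* y
    swap₂ = solve 3 (λ x y z → (x :* y) :* z := (x :* z) :* y) refl
      where open ℕSolver

    cross : ∀ m k → a m ℕ.* suc k ℕ.< suc (a k) ℕ.* suc m
    cross m k = sq-cancel-< (a m ℕ.* suc k) (suc (a k) ℕ.* suc m) (begin-strict
      (a m ℕ.* suc k) ℕ.* (a m ℕ.* suc k)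
        ≡⟨ swap (a m) (suc k) ⟩
      (a m ℕ.* a m) ℕ.* (suc k ℕ.* suc k)
        ≤⟨ ℕ.*-monoˡ-≤ (suc k ℕ.* suc k) (isqrt-lower (n ℕ.* (suc m ℕ.* suc m))) ⟩
      (n ℕ.* (suc m ℕ.* suc m)) ℕ.* (suc k ℕ.* suc k)
        ≡⟨ swap₂ n (suc m ℕ.* suc m) (suc k ℕ.* suc k) ⟩
      (n ℕ.* (suc k ℕ.* suc k)) ℕ.* (suc m ℕ.* suc m)
        <⟨ ℕ.*-monoˡ-< (suc m ℕ.* suc m) (isqrt-upper (n ℕ.* (suc k ℕ.* suc k))) ⟩
      (suc (a k) ℕ.* suc (a k)) ℕ.* (suc m ℕ.* suc m)
        ≡⟨ swap (suc (a k)) (suc m) ⟨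
      (suc (a k) ℕ.* suc m) ℕ.* (suc (a k) ℕ.* suc m) ∎)
      where open ℕ.≤-Reasoning

    close : ∀ ε → 0ℚ ℚ.< ε → ∀ m k → ℚ.↧ₙ ε ℕ.≤ k → √-seq n m ℚ.- √-seq n k ℚ.< ε
    close ε 0<ε m k N≤k = begin-strict
      √-seq n m ℚ.- √-seq n k
        <⟨ ℚ.+-monoˡ-< (ℚ.- √-seq n k) (frac-< {a m} {suc (a k)} m k (cross m k)) ⟩
      (+ suc (a k) ℚ./ suc k) ℚ.- √-seq n k
        ≡⟨ cong (ℚ._- √-seq n k) (frac-suc (a k) k) ⟩
      (√-seq n k ℚ.+ (+ 1 ℚ./ suc k)) ℚ.- √-seq n k
        ≡⟨ cancel (√-seq n k) (+ 1 ℚ./ suc k) ⟩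
      + 1 ℚ./ suc k
        <⟨ 1/suc-< ε 0<ε k N≤k ⟩
      ε ∎
      where
      open ℚ.≤-Reasoning
      cancel : ∀ x y → (x ℚ.+ y) ℚ.- x ≡ y
      cancel = solve 2 (λ x y → (x :+ y) :- x := y) refl
        where open ℚSolver

√ : ℕ → ℝ
√ n = mkℝ (√-seq n) (√-cauchy n)

record ℂ : Set where
  constructor _+i_
  field
    re im : ℝ

open ℂ public

infix  4 _≈ᶜ_
infixl 6 _+ᶜ_
infixl 7 _*ᶜ_

_≈ᶜ_ : ℂ → ℂ → Set
z ≈ᶜ w = re z ≈ᴿ re w × im z ≈ᴿ im w

0ᶜ 1ᶜ : ℂ
0ᶜ = 0ᴿ +i 0ᴿ
1ᶜ = 1ᴿ +i 0ᴿ

_+ᶜ_ _*ᶜ_ : ℂ → ℂ → ℂ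
z +ᶜ w = (re z +ᴿ re w) +i (im z +ᴿ im w)
z *ᶜ w = (re z *ᴿ re w +ᴿ (-ᴿ (im z *ᴿ im w))) +i (re z *ᴿ im w +ᴿ im z *ᴿ re w)

conj : ℂ → ℂ
conj z = re z +i (-ᴿ im z)

∣_∣² : ℂ → ℝ
∣ z ∣² = re z *ᴿ re z +ᴿ im z *ᴿ im z

sumᴿ : ∀ {A : Set} → List A → (A → ℝ) → ℝ
sumᴿ xs f = List.foldr (λ x acc → f x +ᴿ acc) 0ᴿ xs

sumᶜ : ∀ {A : Set} → List A → (A → ℂ) → ℂ
sumᶜ xs f = List.foldr (λ x acc → f x +ᶜ acc) 0ᶜ xs

-- The element c of Fin σ stands for the character toℕ c + 1 of {1,…,σ},
-- and the element i of Fin n for the position toℕ i + 1 of [1..n].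

Str : ℕ → ℕ → Set
Str n σ = Vec (Fin σ) n

suffix : ∀ {n σ} → Str n σ → Fin n → List (Fin σ)
suffix s i = List.drop (toℕ i) (Vec.toList s)

infix 4 _≺_

_≺_ : ∀ {σ} → List (Fin σ) → List (Fin σ) → Set
_≺_ = Lex-< _≡_ Fin._<_

-- P s i says that the position i is the correct output on input s.

Problem : Set₁
Problem = ∀ {n σ} → Str n σ → Fin n → Set

MaximalSuffix : Problem
MaximalSuffix s i = ∀ j → ¬ (j ≡ i) → suffix s j ≺ suffix s i

MinimalSuffix : Problem
MinimalSuffix s i = ∀ j → ¬ (j ≡ i) → suffix s i ≺ suffix s j

-- Number of bits needed for the binary encoding of the characters 1,…,σ.

width : ℕ → ℕ
width σ = suc ⌊log₂ σ ⌋

-- Binary encoding, least significant bit first.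

toBits : ∀ m → ℕ → Vec Bool m
toBits zero    x = []
toBits (suc m) x = (x % 2 ≡ᵇ 1) ∷ toBits m (x / 2)

encode : ∀ σ → Fin σ → Vec Bool (width σ)
encode σ c = toBits (width σ) (suc (toℕ c))

infixl 6 _⊕_

_⊕_ : ∀ {m} → Vec Bool m → Vec Bool m → Vec Bool m
_⊕_ = Vec.zipWith _xor_

allBits : ∀ m → List (Vec Bool m)
allBits zero    = [] ∷ []
allBits (suc m) = List.map (false ∷_) (allBits m) ++ List.map (true ∷_) (allBits m)

-- Computational basis states |i, b, z⟩: the query position, the answer
-- register of m bits, and a workspace of arbitrary finite dimension w on which
-- the oracle acts as the identity.

Basis : ℕ → ℕ → ℕ → Set
Basis n m w = Fin n × Vec Bool m × Fin w

basis : ∀ n m w → List (Basis n m w)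
basis n m w = List.cartesianProduct (List.allFin n)
  (List.cartesianProduct (allBits m) (List.allFin w))

_≟ᴮ_ : ∀ {n m w} → DecidableEquality (Basis n m w)
_≟ᴮ_ = Product.≡-dec Fin._≟_ (Product.≡-dec (Vec.≡-dec Bool._≟_) Fin._≟_)

module _ (n m w : ℕ) where

  State : Set
  State = Basis n m w → ℂ

  -- The entry M x y is ⟨x|M|y⟩.

  Matrix : Set
  Matrix = Basis n m w → Basis n m w → ℂ

module _ {n m w : ℕ} where

  ∣_⟩ : Basis n m w → State n m w
  ∣ y ⟩ x = if ⌊ x ≟ᴮ y ⌋ then 1ᶜ else 0ᶜ

  I : Matrix n m w
  I x y = ∣ y ⟩ x

  _† : Matrix n m w → Matrix n m w
  (M †) x y = conj (M y x)

  _·_ : Matrix n m w → Matrix n m w → Matrix n m w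
  (M · N) x y = sumᶜ (basis n m w) λ z → M x z *ᶜ N z y

  _$_ : Matrix n m w → State n m w → State n m w
  (M $ ψ) x = sumᶜ (basis n m w) λ y → M x y *ᶜ ψ y

  _≈ᴹ_ : Matrix n m w → Matrix n m w → Set
  M ≈ᴹ N = ∀ x y → M x y ≈ᶜ N x y

  IsUnitary : Matrix n m w → Set
  IsUnitary U = ((U †) · U) ≈ᴹ I × (U · (U †)) ≈ᴹ I

record Unitary (n m w : ℕ) : Set where
  field
    matrix    : Matrix n m w
    isUnitary : IsUnitary matrix

open Unitary public

-- O_s |i, b, z⟩ = |i, b ⊕ s[i], z⟩

oracle : ∀ {n σ w} → Str n σ → Matrix n (width σ) w
oracle {σ = σ} s x (i , b , z) = ∣ (i , b ⊕ encode σ (Vec.lookup s i) , z) ⟩ x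

-- A quantum algorithm making T queries to a string of length n over {1,…,σ}.
-- The final state is U_T O_s U_{T-1} O_s ⋯ O_s U_0 |start⟩; it is measured in
-- the computational basis, and the outcome x is reported as output x.

record QueryAlgorithm (n σ T : ℕ) : Set where
  field
    workspace : ℕ
    start     : Basis n (width σ) workspace
    U₀        : Unitary n (width σ) workspace
    Us        : Vec (Unitary n (width σ) workspace) T
    output    : Basis n (width σ) workspace → Fin n

  finalState : Str n σ → State n (width σ) workspace
  finalState s = Vec.foldl (λ _ → State n (width σ) workspace)
    (λ ψ U → matrix U $ (oracle {σ = σ} s $ ψ)) (matrix U₀ $ ∣ start ⟩) Us

  Pr[_outputs_] : Str n σ → Fin n → ℝ
  Pr[ s outputs i ] =
    sumᴿ (List.filter (λ x → output x Fin.≟ i) (basis n (width σ) workspace))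
         (λ x → ∣ finalState s x ∣²)

Solves : ∀ {n σ T} → QueryAlgorithm n σ T → Problem → Set
Solves A P = ∀ s i → P s i → fromℚ (+ 2 ℚ./ 3) ≤ᴿ Pr[ s outputs i ]
  where open QueryAlgorithm A

-- Alphabets have size |Σ| ≤ n^k = n^{O(1)}, with the constants of the Ω
-- depending on k only.  A one-letter alphabet is excluded, since then every
-- length has a single input string and no queries are needed.

Requires-Ω√n-Queries : Problem → Set
Requires-Ω√n-Queries P =
  ∀ (k : ℕ) → ∃[ c ] ∃[ n₀ ] 0ℚ ℚ.< c ×
    (∀ n → n₀ ℕ.≤ n → ∀ σ → 2 ℕ.≤ σ → σ ℕ.≤ n ℕ.^ k →
     ∀ T (A : QueryAlgorithm n σ T) → Solves A P →
     fromℚ c *ᴿ √ n ≤ᴿ fromℕ T)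

{-# OPTIONS --safe #-}

-- The hybrid argument.  Let ψ be the state of the algorithm on the constant
-- string c₀…c₀ and ψᵢ its state on that string with position i overwritten by
-- c₁.  A single query changes ψᵢ relative to ψ only on the part of ψ that
-- queries position i; these parts are orthogonal for distinct i, so after T
-- queries Σᵢ ‖ψᵢ − ψ‖² = O(T²).  If i is the correct output on the i-th marked
-- string, then 2/3 ≤ Pr[ψᵢ outputs i] ≤ 2 Pr[ψ outputs i] + 2 ‖ψᵢ − ψ‖², and
-- summing over i gives 2n/3 ≤ 2 + O(T²).  For Maximal Suffix mark with a larger
-- character, for Minimal Suffix with a smaller one.

module Submission where

open import Algebra.Bundles using (CommutativeSemiring)
open import Algebra.Structures.Biased using (isCommutativeSemiringʳ)
open import Data.Bool.Base using (Bool; true; false; _xor_; if_then_else_)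
import Data.Bool.Properties as Bool
open import Data.Empty using (⊥)
open import Data.Fin.Base as Fin using (Fin)
open import Data.Fin.Patterns using (0F; 1F)
import Data.Fin.Properties as Fin
open import Data.Integer.Base as ℤ using (+_)
import Data.Integer.Properties as ℤ
open import Data.List.Base as List using (List; []; _∷_; allFin; length)
open import Data.List.Membership.Propositional using (_∈_)
open import Data.List.Membership.Propositional.Properties
  using (∈-allFin; ∈-cartesianProduct⁺; ∈-map⁺; ∈-map⁻; ∈-++⁺ˡ; ∈-++⁺ʳ)
import Data.List.Properties as List
open import Data.List.Relation.Binary.Lex.Strict using (this)
open import Data.List.Relation.Unary.All as All using (All; []; _∷_)
open import Data.List.Relation.Unary.AllPairs using ([]; _∷_)
open import Data.List.Relation.Unary.Any using (here; there)
open import Data.List.Relation.Unary.Unique.Propositional using (Unique)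
import Data.List.Relation.Unary.Unique.Propositional.Properties as Unique
open import Data.Nat.Base as ℕ using (ℕ; zero; suc)
import Data.Nat.Properties as ℕ
open import Data.Nat.Solver using () renaming (module +-*-Solver to ℕSolver)
open import Data.Product.Base using (∃-syntax; _×_; _,_; proj₁; proj₂)
open import Data.Rational.Base as ℚ using (ℚ; 0ℚ; 1ℚ; ½; ∣_∣)
import Data.Rational.Properties as ℚ
open import Data.Rational.Solver using () renaming (module +-*-Solver to ℚSolver)
import Data.Rational.Unnormalised.Base as ℚᵘ
import Data.Rational.Unnormalised.Properties as ℚᵘ
open import Data.Sum.Base using (inj₁; inj₂)
open import Data.Vec.Base as Vec using (Vec; []; _∷_; _[_]≔_)
import Data.Vec.Properties as Vec
open import Function.Base using (_∘_)
open import Level using (Level)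
open import Relation.Binary.PropositionalEquality
  using (_≡_; _≢_; refl; sym; trans; cong; cong₂; subst; subst₂)
import Relation.Binary.Reasoning.Setoid
open import Relation.Binary.Structures using (IsEquivalence)
open import Relation.Nullary.Decidable using (⌊_⌋; yes; no)
open import Relation.Nullary.Negation using (contradiction)
open import Relation.Unary using (Pred; Decidable)
open import Defs

-- Norms would be square roots of real numbers, so only squared norms occur, and the triangle
-- inequality becomes |a + b|² ≤ (1 + r)|a|² + (1 + 1/r)|b|² for a rational r > 0. A fixed r is too
-- weak: r = 1 lets the accumulated distance double at each query, which gives only a logarithmic
-- bound on T. The weight therefore depends on time. If D bounds the total squared deviation after t
-- queries and 4 bounds the total squared change caused by one query, then r = 1/(t + 1) gives (1 +
-- 1/(t + 1)) D + (t + 2) · 4 as the next bound, and D = 4 (t + 1)² satisfies this recurrence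
-- exactly. The change caused by a query is always measured on the unmarked run, never on the i-th
-- marked run, so that a single state of norm at most 1 pays for all n positions at once.

-- Finite sums over lists in a commutative semiring.

module ListSum {c ℓ : Level} (R : CommutativeSemiring c ℓ) where

  open CommutativeSemiring R renaming (refl to ≈-refl; sym to ≈-sym; trans to ≈-trans)
  open Relation.Binary.Reasoning.Setoid setoid

  ∑ : ∀ {A : Set} → List A → (A → Carrier) → Carrier
  ∑ xs f = List.foldr (λ x acc → f x + acc) 0# xs

  ∑-cong : ∀ {A : Set} (xs : List A) (f g : A → Carrier) → (∀ x → f x ≈ g x) → ∑ xs f ≈ ∑ xs g
  ∑-cong []       f g f≈g = ≈-refl
  ∑-cong (x ∷ xs) f g f≈g = +-cong (f≈g x) (∑-cong xs f g f≈g)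

  ∑-zero : ∀ {A : Set} (xs : List A) → ∑ xs (λ _ → 0#) ≈ 0#
  ∑-zero []       = ≈-refl
  ∑-zero (x ∷ xs) = ≈-trans (+-identityˡ _) (∑-zero xs)

  +-interchange : ∀ a b c d → (a + b) + (c + d) ≈ (a + c) + (b + d)
  +-interchange a b c d = begin
    (a + b) + (c + d)  ≈⟨ +-assoc a b (c + d) ⟩
    a + (b + (c + d))  ≈⟨ +-congˡ (+-assoc b c d) ⟨
    a + ((b + c) + d)  ≈⟨ +-congˡ (+-congʳ (+-comm b c)) ⟩
    a + ((c + b) + d)  ≈⟨ +-congˡ (+-assoc c b d) ⟩
    a + (c + (b + d))  ≈⟨ +-assoc a c (b + d) ⟨
    (a + c) + (b + d)  ∎

  ∑-+ : ∀ {A : Set} (xs : List A) (f g : A → Carrier) →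
        ∑ xs (λ x → f x + g x) ≈ ∑ xs f + ∑ xs g
  ∑-+ []       f g = ≈-sym (+-identityˡ 0#)
  ∑-+ (x ∷ xs) f g = ≈-trans (+-congˡ (∑-+ xs f g)) (+-interchange _ _ _ _)

  ∑-*ˡ : ∀ {A : Set} (xs : List A) a (f : A → Carrier) → a * ∑ xs f ≈ ∑ xs (λ x → a * f x)
  ∑-*ˡ []       a f = zeroʳ a
  ∑-*ˡ (x ∷ xs) a f = ≈-trans (distribˡ a _ _) (+-congˡ (∑-*ˡ xs a f))

  ∑-*ʳ : ∀ {A : Set} (xs : List A) a (f : A → Carrier) → ∑ xs f * a ≈ ∑ xs (λ x → f x * a)
  ∑-*ʳ []       a f = zeroˡ a
  ∑-*ʳ (x ∷ xs) a f = ≈-trans (distribʳ a _ _) (+-congˡ (∑-*ʳ xs a f))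

  ∑-swap : ∀ {A B : Set} (xs : List A) (ys : List B) (f : A → B → Carrier) →
           ∑ xs (λ x → ∑ ys (f x)) ≈ ∑ ys (λ y → ∑ xs (λ x → f x y))
  ∑-swap []       ys f = ≈-sym (∑-zero ys)
  ∑-swap (x ∷ xs) ys f =
    ≈-trans (+-congˡ (∑-swap xs ys f)) (≈-sym (∑-+ ys (f x) (λ y → ∑ xs (λ x → f x y))))

  -- Evaluates the Kronecker-delta sums of the proof: entries of the identity and of oracles,
  -- changes of variable, disjoint supports. Uniqueness of the list ensures that the surviving term
  -- is counted once.
  ∑-supported : ∀ {A : Set} (xs : List A) (f : A → Carrier) a → Unique xs → a ∈ xs →
                (∀ x → x ≢ a → f x ≈ 0#) → ∑ xs f ≈ f a
  ∑-supported (x ∷ xs) f a (x∉xs ∷ _) (here refl) f≈0 =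
    ≈-trans (+-congˡ (vanish xs x∉xs)) (+-identityʳ _)
    where
    vanish : ∀ ys → All (x ≢_) ys → ∑ ys f ≈ 0#
    vanish []       []         = ≈-refl
    vanish (y ∷ ys) (x≢y ∷ ps) =
      ≈-trans (+-cong (f≈0 y (λ y≡x → x≢y (sym y≡x))) (vanish ys ps)) (+-identityˡ 0#)
  ∑-supported (x ∷ xs) f a (x∉xs ∷ xs!) (there a∈xs) f≈0 =
    ≈-trans (+-cong (f≈0 x (All.lookup x∉xs a∈xs)) (∑-supported xs f a xs! a∈xs f≈0))
            (+-identityˡ _)

  -- With an indicator in place of the filter, the index list no longer depends on the reported
  -- output, so sums over outputs and over basis states can be exchanged.
  ∑-filter : ∀ {A : Set} {p : Level} {P : Pred A p} (P? : Decidable P) (xs : List A) (f : A → Carrier) →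
             ∑ (List.filter P? xs) f ≈ ∑ xs (λ x → if ⌊ P? x ⌋ then f x else 0#)
  ∑-filter P? []       f = ≈-refl
  ∑-filter P? (x ∷ xs) f with P? x
  ... | yes _ = +-congˡ (∑-filter P? xs f)
  ... | no  _ = ≈-trans (∑-filter P? xs f) (≈-sym (+-identityˡ _))

-- Arithmetic and order of the reals.

-- _≈ᴿ_ and _≤ᴿ_ compute to statements about sequences; wrapping them keeps
-- their arguments inferable.

infix 4 _≃_ _≲_ _≃ᶜ_

record _≃_ (x y : ℝ) : Set where
  constructor mk≃
  field get≃ : x ≈ᴿ y

record _≲_ (x y : ℝ) : Set where
  constructor mk≲
  field get≲ : x ≤ᴿ y

open _≃_
open _≲_

≡⇒≃ : ∀ {x y} → (∀ n → seq x n ≡ seq y n) → x ≃ y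
≡⇒≃ {x} {y} e = mk≃ λ ε 0<ε → 0 , λ n _ → subst (λ d → ∣ d ∣ ℚ.< ε)
  (sym (trans (cong (ℚ._- seq y n) (e n)) (ℚ.+-inverseʳ (seq y n)))) 0<ε

≤⇒≲ : ∀ {x y} → (∀ n → seq x n ℚ.≤ seq y n) → x ≲ y
≤⇒≲ {x} {y} p = mk≲ λ ε 0<ε → 0 , λ n _ → ℚ.≤-<-trans (p n)
  (subst (ℚ._< seq y n ℚ.+ ε) (ℚ.+-identityʳ (seq y n)) (ℚ.+-monoʳ-< (seq y n) 0<ε))

p+[q-p]≡q : ∀ p q → p ℚ.+ (q ℚ.- p) ≡ q
p+[q-p]≡q = solve 2 (λ p q → p :+ (q :- p) := q) refl
  where open ℚSolver

half-pos : ∀ {ε} → 0ℚ ℚ.< ε → 0ℚ ℚ.< ½ ℚ.* ε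
half-pos {ε} p = subst (ℚ._< ½ ℚ.* ε) (ℚ.*-zeroʳ ½) (ℚ.*-monoʳ-<-pos ½ p)

half+half : ∀ ε → ½ ℚ.* ε ℚ.+ ½ ℚ.* ε ≡ ε
half+half ε = trans (sym (ℚ.*-distribʳ-+ ε ½ ½)) (ℚ.*-identityˡ ε)

⊔≤⇒ˡ : ∀ {a b n} → a ℕ.⊔ b ℕ.≤ n → a ℕ.≤ n
⊔≤⇒ˡ {a} {b} = ℕ.≤-trans (ℕ.m≤m⊔n a b)

⊔≤⇒ʳ : ∀ {a b n} → a ℕ.⊔ b ℕ.≤ n → b ℕ.≤ n
⊔≤⇒ʳ {a} {b} = ℕ.≤-trans (ℕ.m≤n⊔m a b)

∣+∣<ε : ∀ a b {d ε} → d ≡ a ℚ.+ b → ∣ a ∣ ℚ.< ½ ℚ.* ε → ∣ b ∣ ℚ.< ½ ℚ.* ε → ∣ d ∣ ℚ.< ε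
∣+∣<ε a b {ε = ε} refl p q = ℚ.≤-<-trans (ℚ.∣p+q∣≤∣p∣+∣q∣ a b)
  (subst (∣ a ∣ ℚ.+ ∣ b ∣ ℚ.<_) (half+half ε) (ℚ.+-mono-< p q))

≃-refl : ∀ {x} → x ≃ x
≃-refl = ≡⇒≃ λ _ → refl

≃-sym : ∀ {x y} → x ≃ y → y ≃ x
≃-sym {x} {y} (mk≃ p) = mk≃ λ ε 0<ε → let (N , q) = p ε 0<ε in N , λ n N≤n →
  subst (ℚ._< ε) (trans (sym (ℚ.∣-p∣≡∣p∣ _)) (cong ∣_∣ (flip (seq x n) (seq y n)))) (q n N≤n)
  where
  flip : ∀ a b → ℚ.- (a ℚ.- b) ≡ b ℚ.- a
  flip = solve 2 (λ a b → :- (a :- b) := b :- a) refl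
    where open ℚSolver

≃-trans : ∀ {x y z} → x ≃ y → y ≃ z → x ≃ z
≃-trans {x} {y} {z} (mk≃ p) (mk≃ q) = mk≃ λ ε 0<ε →
  let (N , p′) = p (½ ℚ.* ε) (half-pos 0<ε)
      (M , q′) = q (½ ℚ.* ε) (half-pos 0<ε)
  in N ℕ.⊔ M , λ n le → ∣+∣<ε (seq x n ℚ.- seq y n) (seq y n ℚ.- seq z n)
       (split (seq x n) (seq y n) (seq z n)) (p′ n (⊔≤⇒ˡ {N} le)) (q′ n (⊔≤⇒ʳ {N} le))
  where
  split : ∀ a b c → a ℚ.- c ≡ (a ℚ.- b) ℚ.+ (b ℚ.- c)
  split = solve 3 (λ a b c → a :- c := (a :- b) :+ (b :- c)) refl
    where open ℚSolver

≃-isEquivalence : IsEquivalence _≃_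
≃-isEquivalence = record { refl = ≃-refl ; sym = ≃-sym ; trans = ≃-trans }

+ᴿ-cong : ∀ {x x′ y y′} → x ≃ x′ → y ≃ y′ → x +ᴿ y ≃ x′ +ᴿ y′
+ᴿ-cong {x} {x′} {y} {y′} (mk≃ p) (mk≃ q) = mk≃ λ ε 0<ε →
  let (N , p′) = p (½ ℚ.* ε) (half-pos 0<ε)
      (M , q′) = q (½ ℚ.* ε) (half-pos 0<ε)
  in N ℕ.⊔ M , λ n le → ∣+∣<ε (seq x n ℚ.- seq x′ n) (seq y n ℚ.- seq y′ n)
       (split (seq x n) (seq x′ n) (seq y n) (seq y′ n))
       (p′ n (⊔≤⇒ˡ {N} le)) (q′ n (⊔≤⇒ʳ {N} le))
  where
  split : ∀ a b c d → (a ℚ.+ c) ℚ.- (b ℚ.+ d) ≡ (a ℚ.- b) ℚ.+ (c ℚ.- d)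
  split = solve 4 (λ a b c d → (a :+ c) :- (b :+ d) := (a :- b) :+ (c :- d)) refl
    where open ℚSolver

-ᴿ-cong : ∀ {x y} → x ≃ y → -ᴿ x ≃ -ᴿ y
-ᴿ-cong {x} {y} (mk≃ p) = mk≃ λ ε 0<ε → let (N , q) = p ε 0<ε in N , λ n N≤n →
  subst (ℚ._< ε) (trans (sym (ℚ.∣-p∣≡∣p∣ _)) (cong ∣_∣ (neg (seq x n) (seq y n)))) (q n N≤n)
  where
  neg : ∀ a b → ℚ.- (a ℚ.- b) ≡ (ℚ.- a) ℚ.- (ℚ.- b)
  neg = solve 2 (λ a b → :- (a :- b) := (:- a) :- (:- b)) refl
    where open ℚSolver

quotient : ∀ c ε → 0ℚ ℚ.< c → 0ℚ ℚ.< ε → ∃[ δ ] 0ℚ ℚ.< δ × c ℚ.* δ ≡ ε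
quotient c ε 0<c 0<ε = c⁻¹ ℚ.* ε
  , subst (ℚ._< c⁻¹ ℚ.* ε) (ℚ.*-zeroʳ c⁻¹)
      (ℚ.*-monoʳ-<-pos c⁻¹ {{ℚ.1/pos⇒pos c {{ℚ.positive 0<c}}}} 0<ε)
  , trans (sym (ℚ.*-assoc c c⁻¹ ε))
      (trans (cong (ℚ._* ε) (ℚ.*-inverseʳ c {{ℚ.>-nonZero 0<c}})) (ℚ.*-identityˡ ε))
  where
  c⁻¹ = ℚ.1/_ c {{ℚ.>-nonZero 0<c}}

bounded : ∀ x → ∃[ B ] 0ℚ ℚ.< B × ∃[ N ] ∀ n → N ℕ.≤ n → ∣ seq x n ∣ ℚ.≤ B
bounded x =
  let (N , p) = cauchy x 1ℚ (ℚ.positive⁻¹ 1ℚ)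
      b       = ∣ seq x N ∣
  in b ℚ.+ 1ℚ
   , ℚ.<-≤-trans (ℚ.positive⁻¹ 1ℚ)
       (subst (ℚ._≤ b ℚ.+ 1ℚ) (ℚ.+-identityˡ 1ℚ) (ℚ.+-monoˡ-≤ 1ℚ (ℚ.0≤∣p∣ (seq x N))))
   , N , λ n N≤n → ℚ.≤-trans
       (subst (λ d → ∣ d ∣ ℚ.≤ b ℚ.+ ∣ seq x n ℚ.- seq x N ∣) (p+[q-p]≡q (seq x N) (seq x n))
         (ℚ.∣p+q∣≤∣p∣+∣q∣ (seq x N) (seq x n ℚ.- seq x N)))
       (ℚ.+-monoʳ-≤ b (ℚ.<⇒≤ (p n N N≤n ℕ.≤-refl)))

*ᴿ-congˡ : ∀ x {y y′} → y ≃ y′ → x *ᴿ y ≃ x *ᴿ y′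
*ᴿ-congˡ x {y} {y′} (mk≃ p) = mk≃ λ ε 0<ε →
  let (B , 0<B , N , b)  = bounded x
      (δ , 0<δ , B*δ≡ε) = quotient B ε 0<B 0<ε
      (M , q)            = p δ 0<δ
  in N ℕ.⊔ M , λ n le →
     let d = seq y n ℚ.- seq y′ n in
     subst₂ ℚ._<_
       (trans (sym (ℚ.∣p*q∣≡∣p∣*∣q∣ (seq x n) d))
         (cong ∣_∣ (distrib (seq x n) (seq y n) (seq y′ n))))
       B*δ≡ε
       (ℚ.≤-<-trans
         (ℚ.*-monoʳ-≤-nonNeg ∣ d ∣ {{ℚ.∣-∣-nonNeg d}} (b n (⊔≤⇒ˡ {N} le)))
         (ℚ.*-monoʳ-<-pos B {{ℚ.positive 0<B}} (q n (⊔≤⇒ʳ {N} le))))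
  where
  distrib : ∀ a b c → a ℚ.* (b ℚ.- c) ≡ a ℚ.* b ℚ.- a ℚ.* c
  distrib = solve 3 (λ a b c → a :* (b :- c) := a :* b :- a :* c) refl
    where open ℚSolver

*ᴿ-comm : ∀ x y → x *ᴿ y ≃ y *ᴿ x
*ᴿ-comm x y = ≡⇒≃ λ n → ℚ.*-comm (seq x n) (seq y n)

*ᴿ-cong : ∀ {x x′ y y′} → x ≃ x′ → y ≃ y′ → x *ᴿ y ≃ x′ *ᴿ y′
*ᴿ-cong {x} {x′} {y} {y′} p q = ≃-trans (*ᴿ-congˡ x q)
  (≃-trans (*ᴿ-comm x y′) (≃-trans (*ᴿ-congˡ y′ p) (*ᴿ-comm y′ x′)))

-- The operations act termwise on approximating sequences, so each algebraic law is the rational law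
-- at every index; only the congruences need an ε.
ℝ-commutativeSemiring : CommutativeSemiring _ _
ℝ-commutativeSemiring = record
  { Carrier = ℝ ; _≈_ = _≃_ ; _+_ = _+ᴿ_ ; _*_ = _*ᴿ_ ; 0# = 0ᴿ ; 1# = 1ᴿ
  ; isCommutativeSemiring = isCommutativeSemiringʳ record
    { +-isCommutativeMonoid = record
      { isMonoid = record
        { isSemigroup = record
          { isMagma = record { isEquivalence = ≃-isEquivalence ; ∙-cong = +ᴿ-cong }
          ; assoc   = λ x y z → ≡⇒≃ λ n → ℚ.+-assoc (seq x n) (seq y n) (seq z n) }
        ; identity = (λ x → ≡⇒≃ λ n → ℚ.+-identityˡ (seq x n))
                   , (λ x → ≡⇒≃ λ n → ℚ.+-identityʳ (seq x n)) }
      ; comm = λ x y → ≡⇒≃ λ n → ℚ.+-comm (seq x n) (seq y n) }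
    ; *-isCommutativeMonoid = record
      { isMonoid = record
        { isSemigroup = record
          { isMagma = record { isEquivalence = ≃-isEquivalence ; ∙-cong = *ᴿ-cong }
          ; assoc   = λ x y z → ≡⇒≃ λ n → ℚ.*-assoc (seq x n) (seq y n) (seq z n) }
        ; identity = (λ x → ≡⇒≃ λ n → ℚ.*-identityˡ (seq x n))
                   , (λ x → ≡⇒≃ λ n → ℚ.*-identityʳ (seq x n)) }
      ; comm = *ᴿ-comm }
    ; distribˡ = λ x y z → ≡⇒≃ λ n → ℚ.*-distribˡ-+ (seq x n) (seq y n) (seq z n)
    ; zeroʳ    = λ x → ≡⇒≃ λ n → ℚ.*-zeroʳ (seq x n) } }

p≤∣p∣ : ∀ p → p ℚ.≤ ∣ p ∣
p≤∣p∣ p with ℚ.≤-total 0ℚ p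
... | inj₁ 0≤p = ℚ.≤-reflexive (sym (ℚ.0≤p⇒∣p∣≡p 0≤p))
... | inj₂ p≤0 = ℚ.≤-trans p≤0 (ℚ.0≤∣p∣ p)

≃⇒≲ : ∀ {x y} → x ≃ y → x ≲ y
≃⇒≲ {x} {y} (mk≃ p) = mk≲ λ ε 0<ε → let (N , q) = p ε 0<ε in N , λ n N≤n →
  subst (ℚ._< seq y n ℚ.+ ε) (p+[q-p]≡q (seq y n) (seq x n))
    (ℚ.+-monoʳ-< (seq y n) (ℚ.≤-<-trans (p≤∣p∣ _) (q n N≤n)))

≲-refl : ∀ {x} → x ≲ x
≲-refl = ≃⇒≲ ≃-refl

≲-trans : ∀ {x y z} → x ≲ y → y ≲ z → x ≲ z
≲-trans {x} {y} {z} (mk≲ p) (mk≲ q) = mk≲ λ ε 0<ε →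
  let (N , p′) = p (½ ℚ.* ε) (half-pos 0<ε)
      (M , q′) = q (½ ℚ.* ε) (half-pos 0<ε)
  in N ℕ.⊔ M , λ n le → ℚ.<-trans (p′ n (⊔≤⇒ˡ {N} le))
       (subst (seq y n ℚ.+ ½ ℚ.* ε ℚ.<_)
         (trans (ℚ.+-assoc (seq z n) (½ ℚ.* ε) (½ ℚ.* ε)) (cong (seq z n ℚ.+_) (half+half ε)))
         (ℚ.+-monoˡ-< (½ ℚ.* ε) (q′ n (⊔≤⇒ʳ {N} le))))

+ᴿ-mono : ∀ {x x′ y y′} → x ≲ x′ → y ≲ y′ → x +ᴿ y ≲ x′ +ᴿ y′
+ᴿ-mono {x} {x′} {y} {y′} (mk≲ p) (mk≲ q) = mk≲ λ ε 0<ε →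
  let (N , p′) = p (½ ℚ.* ε) (half-pos 0<ε)
      (M , q′) = q (½ ℚ.* ε) (half-pos 0<ε)
  in N ℕ.⊔ M , λ n le → subst (seq x n ℚ.+ seq y n ℚ.<_)
       (trans (split (seq x′ n) (seq y′ n) (½ ℚ.* ε)) (cong (seq x′ n ℚ.+ seq y′ n ℚ.+_) (half+half ε)))
       (ℚ.+-mono-< (p′ n (⊔≤⇒ˡ {N} le)) (q′ n (⊔≤⇒ʳ {N} le)))
  where
  split : ∀ a b h → (a ℚ.+ h) ℚ.+ (b ℚ.+ h) ≡ (a ℚ.+ b) ℚ.+ (h ℚ.+ h)
  split = solve 3 (λ a b h → (a :+ h) :+ (b :+ h) := (a :+ b) :+ (h :+ h)) refl
    where open ℚSolver

-- Rational factors suffice because every weight in the argument is a rational constant; the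
-- tolerance for the hypothesis is then simply ε / c.
scale-mono : ∀ c {x y} → 0ℚ ℚ.< c → x ≲ y → fromℚ c *ᴿ x ≲ fromℚ c *ᴿ y
scale-mono c {x} {y} 0<c (mk≲ p) = mk≲ λ ε 0<ε →
  let (δ , 0<δ , c*δ≡ε) = quotient c ε 0<c 0<ε
      (N , q)            = p δ 0<δ
  in N , λ n N≤n → subst (c ℚ.* seq x n ℚ.<_)
       (trans (ℚ.*-distribˡ-+ c (seq y n) δ) (cong (c ℚ.* seq y n ℚ.+_) c*δ≡ε))
       (ℚ.*-monoʳ-<-pos c {{ℚ.positive 0<c}} (q n N≤n))

-- The way back from real estimates to exact arithmetic: if q < p, the tolerance p - q would give p
-- < p.
fromℚ-cancel-≲ : ∀ {p q} → fromℚ p ≲ fromℚ q → p ℚ.≤ q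
fromℚ-cancel-≲ {p} {q} (mk≲ h) = ℚ.≮⇒≥ λ q<p →
  let (N , r) = h (p ℚ.- q) (subst (ℚ._< p ℚ.- q) (ℚ.+-inverseʳ q) (ℚ.+-monoˡ-< (ℚ.- q) q<p))
  in ℚ.<-irrefl (sym (p+[q-p]≡q q p)) (r N ℕ.≤-refl)

-- Arithmetic of the complex numbers.

record _≃ᶜ_ (z w : ℂ) : Set where
  constructor mkᶜ
  field
    re≃ : re z ≃ re w
    im≃ : im z ≃ im w

open _≃ᶜ_

≃ᶜ-isEquivalence : IsEquivalence _≃ᶜ_
≃ᶜ-isEquivalence = record
  { refl  = mkᶜ ≃-refl ≃-refl
  ; sym   = λ p → mkᶜ (≃-sym (re≃ p)) (≃-sym (im≃ p))
  ; trans = λ p q → mkᶜ (≃-trans (re≃ p) (re≃ q)) (≃-trans (im≃ p) (im≃ q)) }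

≡⇒≃ᶜ : ∀ {z w} → (∀ n → seq (re z) n ≡ seq (re w) n) → (∀ n → seq (im z) n ≡ seq (im w) n) → z ≃ᶜ w
≡⇒≃ᶜ p q = mkᶜ (≡⇒≃ p) (≡⇒≃ q)

ℂ-commutativeSemiring : CommutativeSemiring _ _
ℂ-commutativeSemiring = record
  { Carrier = ℂ ; _≈_ = _≃ᶜ_ ; _+_ = _+ᶜ_ ; _*_ = _*ᶜ_ ; 0# = 0ᶜ ; 1# = 1ᶜ
  ; isCommutativeSemiring = isCommutativeSemiringʳ record
    { +-isCommutativeMonoid = record
      { isMonoid = record
        { isSemigroup = record
          { isMagma = record
            { isEquivalence = ≃ᶜ-isEquivalence
            ; ∙-cong = λ p q → mkᶜ (+ᴿ-cong (re≃ p) (re≃ q)) (+ᴿ-cong (im≃ p) (im≃ q)) }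
          ; assoc = λ x y z → ≡⇒≃ᶜ
              (λ n → ℚ.+-assoc (seq (re x) n) (seq (re y) n) (seq (re z) n))
              (λ n → ℚ.+-assoc (seq (im x) n) (seq (im y) n) (seq (im z) n)) }
        ; identity = (λ x → ≡⇒≃ᶜ (λ n → ℚ.+-identityˡ (seq (re x) n)) (λ n → ℚ.+-identityˡ (seq (im x) n)))
                   , (λ x → ≡⇒≃ᶜ (λ n → ℚ.+-identityʳ (seq (re x) n)) (λ n → ℚ.+-identityʳ (seq (im x) n))) }
      ; comm = λ x y → ≡⇒≃ᶜ (λ n → ℚ.+-comm (seq (re x) n) (seq (re y) n))
                            (λ n → ℚ.+-comm (seq (im x) n) (seq (im y) n)) }
    ; *-isCommutativeMonoid = record
      { isMonoid = record
        { isSemigroup = record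
          { isMagma = record
            { isEquivalence = ≃ᶜ-isEquivalence
            ; ∙-cong = λ p q → mkᶜ
                (+ᴿ-cong (*ᴿ-cong (re≃ p) (re≃ q)) (-ᴿ-cong (*ᴿ-cong (im≃ p) (im≃ q))))
                (+ᴿ-cong (*ᴿ-cong (re≃ p) (im≃ q)) (*ᴿ-cong (im≃ p) (re≃ q))) }
          ; assoc = λ x y z → ≡⇒≃ᶜ
              (λ n → *-assoc-re (seq (re x) n) (seq (im x) n) (seq (re y) n)
                                (seq (im y) n) (seq (re z) n) (seq (im z) n))
              (λ n → *-assoc-im (seq (re x) n) (seq (im x) n) (seq (re y) n)
                                (seq (im y) n) (seq (re z) n) (seq (im z) n)) }
        ; identity = (λ x → ≡⇒≃ᶜ
                        (λ n → 1*-re (seq (re x) n) (seq (im x) n))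
                        (λ n → 1*-im (seq (re x) n) (seq (im x) n)))
                   , (λ x → ≡⇒≃ᶜ
                        (λ n → *1-re (seq (re x) n) (seq (im x) n))
                        (λ n → *1-im (seq (re x) n) (seq (im x) n))) }
      ; comm = λ x y → ≡⇒≃ᶜ
          (λ n → *-comm-re (seq (re x) n) (seq (im x) n) (seq (re y) n) (seq (im y) n))
          (λ n → *-comm-im (seq (re x) n) (seq (im x) n) (seq (re y) n) (seq (im y) n)) }
    ; distribˡ = λ x y z → ≡⇒≃ᶜ
        (λ n → distrib-re (seq (re x) n) (seq (im x) n) (seq (re y) n)
                          (seq (im y) n) (seq (re z) n) (seq (im z) n))
        (λ n → distrib-im (seq (re x) n) (seq (im x) n) (seq (re y) n)
                          (seq (im y) n) (seq (re z) n) (seq (im z) n))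
    ; zeroʳ = λ x → ≡⇒≃ᶜ
        (λ n → *0-re (seq (re x) n) (seq (im x) n))
        (λ n → *0-im (seq (re x) n) (seq (im x) n)) } }
  where
  open ℚSolver
  *-assoc-re = solve 6 (λ a b c d e f →
    (a :* c :+ :- (b :* d)) :* e :+ :- ((a :* d :+ b :* c) :* f) :=
    a :* (c :* e :+ :- (d :* f)) :+ :- (b :* (c :* f :+ d :* e))) refl
  *-assoc-im = solve 6 (λ a b c d e f →
    (a :* c :+ :- (b :* d)) :* f :+ (a :* d :+ b :* c) :* e :=
    a :* (c :* f :+ d :* e) :+ b :* (c :* e :+ :- (d :* f))) refl
  1*-re = solve 2 (λ a b → con 1ℚ :* a :+ :- (con 0ℚ :* b) := a) refl
  1*-im = solve 2 (λ a b → con 1ℚ :* b :+ con 0ℚ :* a := b) refl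
  *1-re = solve 2 (λ a b → a :* con 1ℚ :+ :- (b :* con 0ℚ) := a) refl
  *1-im = solve 2 (λ a b → a :* con 0ℚ :+ b :* con 1ℚ := b) refl
  *0-re = solve 2 (λ a b → a :* con 0ℚ :+ :- (b :* con 0ℚ) := con 0ℚ) refl
  *0-im = solve 2 (λ a b → a :* con 0ℚ :+ b :* con 0ℚ := con 0ℚ) refl
  *-comm-re = solve 4 (λ a b c d → a :* c :+ :- (b :* d) := c :* a :+ :- (d :* b)) refl
  *-comm-im = solve 4 (λ a b c d → a :* d :+ b :* c := c :* b :+ d :* a) refl
  distrib-re = solve 6 (λ a b c d e f →
    a :* (c :+ e) :+ :- (b :* (d :+ f)) :=
    (a :* c :+ :- (b :* d)) :+ (a :* e :+ :- (b :* f))) refl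
  distrib-im = solve 6 (λ a b c d e f →
    a :* (d :+ f) :+ b :* (c :+ e) :=
    (a :* d :+ b :* c) :+ (a :* f :+ b :* e)) refl

module Rˢ = CommutativeSemiring ℝ-commutativeSemiring
module Cˢ = CommutativeSemiring ℂ-commutativeSemiring
module Σᴿ = ListSum ℝ-commutativeSemiring
module Σᶜ = ListSum ℂ-commutativeSemiring

≲-respˡ : ∀ {x y z} → x ≃ y → y ≲ z → x ≲ z
≲-respˡ p = ≲-trans (≃⇒≲ p)

≲-respʳ : ∀ {x y z} → y ≃ z → x ≲ y → x ≲ z
≲-respʳ p q = ≲-trans q (≃⇒≲ p)

sumᴿ-mono : ∀ {A : Set} (xs : List A) (f g : A → ℝ) → (∀ x → f x ≲ g x) → sumᴿ xs f ≲ sumᴿ xs g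
sumᴿ-mono []       f g f≲g = ≲-refl
sumᴿ-mono (x ∷ xs) f g f≲g = +ᴿ-mono (f≲g x) (sumᴿ-mono xs f g f≲g)

sumᴿ-linear : ∀ {A : Set} (xs : List A) a b (f g : A → ℝ) →
              sumᴿ xs (λ x → a *ᴿ f x +ᴿ b *ᴿ g x) ≃ a *ᴿ sumᴿ xs f +ᴿ b *ᴿ sumᴿ xs g
sumᴿ-linear xs a b f g = ≃-trans (Σᴿ.∑-+ xs (λ x → a *ᴿ f x) (λ x → b *ᴿ g x))
  (+ᴿ-cong (≃-sym (Σᴿ.∑-*ˡ xs a f)) (≃-sym (Σᴿ.∑-*ˡ xs b g)))

-- Squared absolute values and weighted AM-GM.

-ᶜ_ : ℂ → ℂ
-ᶜ z = (-ᴿ re z) +i (-ᴿ im z)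

∣∣²-cong : ∀ {z w} → z ≃ᶜ w → ∣ z ∣² ≃ ∣ w ∣²
∣∣²-cong p = +ᴿ-cong (*ᴿ-cong (re≃ p) (re≃ p)) (*ᴿ-cong (im≃ p) (im≃ p))

∣-∣² : ∀ z → ∣ -ᶜ z ∣² ≃ ∣ z ∣²
∣-∣² z = ≡⇒≃ λ n → eq (seq (re z) n) (seq (im z) n)
  where
  open ℚSolver
  eq = solve 2 (λ a b → (:- a) :* (:- a) :+ (:- b) :* (:- b) := a :* a :+ b :* b) refl

0≤p*p : ∀ p → 0ℚ ℚ.≤ p ℚ.* p
0≤p*p p with ℚ.∣p∣≡p∨∣p∣≡-p p
... | inj₁ e = subst (0ℚ ℚ.≤_) (trans (ℚ.∣p*q∣≡∣p∣*∣q∣ p p) (cong₂ ℚ._*_ e e)) (ℚ.0≤∣p∣ (p ℚ.* p))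
... | inj₂ e = subst (0ℚ ℚ.≤_) (trans (trans (ℚ.∣p*q∣≡∣p∣*∣q∣ p p) (cong₂ ℚ._*_ e e)) (neg² p))
    (ℚ.0≤∣p∣ (p ℚ.* p))
  where
  neg² : ∀ p → (ℚ.- p) ℚ.* (ℚ.- p) ≡ p ℚ.* p
  neg² = solve 1 (λ a → (:- a) :* (:- a) := a :* a) refl
    where open ℚSolver

-- Weighted AM–GM: the difference of the two sides is r (a − s b)² when r s = 1.

square-+-≤ : ∀ r s a b → 0ℚ ℚ.< r → r ℚ.* s ≡ 1ℚ →
  (a ℚ.+ b) ℚ.* (a ℚ.+ b) ℚ.≤ (1ℚ ℚ.+ r) ℚ.* (a ℚ.* a) ℚ.+ (1ℚ ℚ.+ s) ℚ.* (b ℚ.* b)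
square-+-≤ r s a b 0<r rs≡1 = subst₂ ℚ._≤_ (ℚ.+-identityʳ _)
  (trans (expand r s a b) (trans (cong expanded rs≡1) (collect r s a b)))
  (ℚ.+-monoʳ-≤ ((a ℚ.+ b) ℚ.* (a ℚ.+ b))
    (subst (ℚ._≤ r ℚ.* (d ℚ.* d)) (ℚ.*-zeroʳ r)
      (ℚ.*-monoˡ-≤-nonNeg r {{ℚ.nonNegative (ℚ.<⇒≤ 0<r)}} (0≤p*p d))))
  where
  d = a ℚ.- s ℚ.* b
  expanded : ℚ → ℚ
  expanded k = (1ℚ ℚ.+ r) ℚ.* (a ℚ.* a) ℚ.+ (1ℚ ℚ.+ k ℚ.* s) ℚ.* (b ℚ.* b)
             ℚ.+ (1ℚ ℚ.- k) ℚ.* (a ℚ.* b ℚ.+ a ℚ.* b)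
  open ℚSolver
  expand = solve 4 (λ r s a b →
    (a :+ b) :* (a :+ b) :+ r :* ((a :- s :* b) :* (a :- s :* b)) :=
    (con 1ℚ :+ r) :* (a :* a) :+ (con 1ℚ :+ (r :* s) :* s) :* (b :* b)
      :+ (con 1ℚ :- r :* s) :* (a :* b :+ a :* b)) refl
  collect = solve 4 (λ r s a b →
    (con 1ℚ :+ r) :* (a :* a) :+ (con 1ℚ :+ con 1ℚ :* s) :* (b :* b)
      :+ (con 1ℚ :- con 1ℚ) :* (a :* b :+ a :* b) :=
    (con 1ℚ :+ r) :* (a :* a) :+ (con 1ℚ :+ s) :* (b :* b)) refl

-- The root-free substitute for the triangle inequality. The rational inequality applies to the real
-- and the imaginary approximations at each index separately.
∣+∣²-≲ : ∀ r s z w → 0ℚ ℚ.< r → r ℚ.* s ≡ 1ℚ →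
         ∣ z +ᶜ w ∣² ≲ fromℚ (1ℚ ℚ.+ r) *ᴿ ∣ z ∣² +ᴿ fromℚ (1ℚ ℚ.+ s) *ᴿ ∣ w ∣²
∣+∣²-≲ r s z w 0<r rs≡1 = ≤⇒≲ λ n → subst (_ ℚ.≤_)
  (regroup (1ℚ ℚ.+ r) (1ℚ ℚ.+ s) (sq (re z) n) (sq (re w) n) (sq (im z) n) (sq (im w) n))
  (ℚ.+-mono-≤ (square-+-≤ r s (seq (re z) n) (seq (re w) n) 0<r rs≡1)
              (square-+-≤ r s (seq (im z) n) (seq (im w) n) 0<r rs≡1))
  where
  sq : ℝ → ℕ → ℚ
  sq x n = seq x n ℚ.* seq x n
  regroup : ∀ r s a b c d → (r ℚ.* a ℚ.+ s ℚ.* b) ℚ.+ (r ℚ.* c ℚ.+ s ℚ.* d)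
                          ≡ r ℚ.* (a ℚ.+ c) ℚ.+ s ℚ.* (b ℚ.+ d)
  regroup = solve 6 (λ r s a b c d → (r :* a :+ s :* b) :+ (r :* c :+ s :* d)
                          := r :* (a :+ c) :+ s :* (b :+ d)) refl
    where open ℚSolver

2ℚ : ℚ
2ℚ = 1ℚ ℚ.+ 1ℚ

∣+∣²-≲-2 : ∀ z w → ∣ z +ᶜ w ∣² ≲ fromℚ 2ℚ *ᴿ ∣ z ∣² +ᴿ fromℚ 2ℚ *ᴿ ∣ w ∣²
∣+∣²-≲-2 z w = ∣+∣²-≲ 1ℚ 1ℚ z w (ℚ.positive⁻¹ 1ℚ) refl

∣∣²-nonneg : ∀ z → 0ᴿ ≲ ∣ z ∣²
∣∣²-nonneg z = ≤⇒≲ λ n → ℚ.+-mono-≤ (0≤p*p (seq (re z) n)) (0≤p*p (seq (im z) n))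

-- The enumeration of the computational basis is complete and duplicate-free.

allBits-complete : ∀ {m} (b : Vec Bool m) → b ∈ allBits m
allBits-complete []          = here refl
allBits-complete (false ∷ b) = ∈-++⁺ˡ (∈-map⁺ (false ∷_) (allBits-complete b))
allBits-complete {suc m} (true ∷ b) =
  ∈-++⁺ʳ (List.map (false ∷_) (allBits m)) (∈-map⁺ (true ∷_) (allBits-complete b))

allBits-unique : ∀ m → Unique (allBits m)
allBits-unique zero    = [] ∷ []
allBits-unique (suc m) = Unique.++⁺
  (Unique.map⁺ Vec.∷-injectiveʳ (allBits-unique m))
  (Unique.map⁺ Vec.∷-injectiveʳ (allBits-unique m))
  λ (p , q) → disjoint (∈-map⁻ (false ∷_) p) (∈-map⁻ (true ∷_) q)
  where
  disjoint : ∀ {v} → ∃[ b ] (b ∈ allBits m × v ≡ false ∷ b) →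
             ∃[ b ] (b ∈ allBits m × v ≡ true ∷ b) → ⊥
  disjoint (_ , _ , refl) (_ , _ , ())

basis-complete : ∀ {n m w} (x : Basis n m w) → x ∈ basis n m w
basis-complete (i , b , z) =
  ∈-cartesianProduct⁺ (∈-allFin i) (∈-cartesianProduct⁺ (allBits-complete b) (∈-allFin z))

basis-unique : ∀ n m w → Unique (basis n m w)
basis-unique n m w = Unique.cartesianProduct⁺ (Unique.allFin⁺ n)
  (Unique.cartesianProduct⁺ (allBits-unique m) (Unique.allFin⁺ w))

-- Unitaries and oracles preserve the norm.

re-sumᶜ : ∀ {A : Set} (xs : List A) (f : A → ℂ) → re (sumᶜ xs f) ≃ sumᴿ xs (λ x → re (f x))
re-sumᶜ []       f = ≃-refl
re-sumᶜ (x ∷ xs) f = +ᴿ-cong ≃-refl (re-sumᶜ xs f)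

conj-+ : ∀ z w → conj (z +ᶜ w) ≃ᶜ conj z +ᶜ conj w
conj-+ z w = ≡⇒≃ᶜ (λ _ → refl) (λ n → ℚ.neg-distrib-+ (seq (im z) n) (seq (im w) n))

conj-* : ∀ z w → conj (z *ᶜ w) ≃ᶜ conj z *ᶜ conj w
conj-* z w = ≡⇒≃ᶜ (λ n → eq-re (seq (re z) n) (seq (im z) n) (seq (re w) n) (seq (im w) n))
                  (λ n → eq-im (seq (re z) n) (seq (im z) n) (seq (re w) n) (seq (im w) n))
  where
  open ℚSolver
  eq-re = solve 4 (λ a b c d → a :* c :+ :- (b :* d) := a :* c :+ :- ((:- b) :* (:- d))) refl
  eq-im = solve 4 (λ a b c d → :- (a :* d :+ b :* c) := a :* (:- d) :+ (:- b) :* c) refl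

conj-sumᶜ : ∀ {A : Set} (xs : List A) (f : A → ℂ) →
            conj (sumᶜ xs f) ≃ᶜ sumᶜ xs (λ x → conj (f x))
conj-sumᶜ []       f = ≡⇒≃ᶜ (λ _ → refl) (λ _ → refl)
conj-sumᶜ (x ∷ xs) f =
  Cˢ.trans (conj-+ (f x) (sumᶜ xs f)) (Cˢ.+-congˡ (conj-sumᶜ xs f))

module _ {n m w : ℕ} where

  ‖_‖² : State n m w → ℝ
  ‖ ψ ‖² = sumᴿ (basis n m w) λ x → ∣ ψ x ∣²

  ‖‖²-cong : ∀ φ ψ → (∀ x → φ x ≃ᶜ ψ x) → ‖ φ ‖² ≃ ‖ ψ ‖²
  ‖‖²-cong φ ψ p = Σᴿ.∑-cong (basis n m w) (λ x → ∣ φ x ∣²) (λ x → ∣ ψ x ∣²) λ x → ∣∣²-cong (p x)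

  ‖+‖²-≲ : ∀ r s (φ ψ : State n m w) → 0ℚ ℚ.< r → r ℚ.* s ≡ 1ℚ →
           ‖ (λ x → φ x +ᶜ ψ x) ‖² ≲ fromℚ (1ℚ ℚ.+ r) *ᴿ ‖ φ ‖² +ᴿ fromℚ (1ℚ ℚ.+ s) *ᴿ ‖ ψ ‖²
  ‖+‖²-≲ r s φ ψ 0<r rs≡1 = ≲-respʳ
    (sumᴿ-linear (basis n m w) (fromℚ (1ℚ ℚ.+ r)) (fromℚ (1ℚ ℚ.+ s)) (λ x → ∣ φ x ∣²) (λ x → ∣ ψ x ∣²))
    (sumᴿ-mono (basis n m w) (λ x → ∣ φ x +ᶜ ψ x ∣²) _ λ x → ∣+∣²-≲ r s (φ x) (ψ x) 0<r rs≡1)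

  $-cong : ∀ (M : Matrix n m w) φ ψ → (∀ x → φ x ≃ᶜ ψ x) → ∀ x → (M $ φ) x ≃ᶜ (M $ ψ) x
  $-cong M φ ψ p x = Σᶜ.∑-cong (basis n m w) (λ y → M x y *ᶜ φ y) (λ y → M x y *ᶜ ψ y)
    λ y → Cˢ.*-congˡ (p y)

  $-+ : ∀ (M : Matrix n m w) φ ψ x → (M $ (λ y → φ y +ᶜ ψ y)) x ≃ᶜ (M $ φ) x +ᶜ (M $ ψ) x
  $-+ M φ ψ x = Cˢ.trans
    (Σᶜ.∑-cong (basis n m w) (λ y → M x y *ᶜ (φ y +ᶜ ψ y)) (λ y → M x y *ᶜ φ y +ᶜ M x y *ᶜ ψ y)
      λ y → Cˢ.distribˡ (M x y) (φ y) (ψ y))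
    (Σᶜ.∑-+ (basis n m w) (λ y → M x y *ᶜ φ y) (λ y → M x y *ᶜ ψ y))

  -- ⟨ψ|ψ⟩ is kept complex because unitarity is an identity of complex matrices; `re-inner` carries
  -- the result to the real squared norm.
  inner : State n m w → ℂ
  inner ψ = sumᶜ (basis n m w) λ x → conj (ψ x) *ᶜ ψ x

  re-inner : ∀ ψ → re (inner ψ) ≃ ‖ ψ ‖²
  re-inner ψ = ≃-trans (re-sumᶜ (basis n m w) (λ x → conj (ψ x) *ᶜ ψ x))
    (Σᴿ.∑-cong (basis n m w) (λ x → re (conj (ψ x) *ᶜ ψ x)) (λ x → ∣ ψ x ∣²)
      λ x → ≡⇒≃ λ k → eq (seq (re (ψ x)) k) (seq (im (ψ x)) k))
    where
    open ℚSolver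
    eq = solve 2 (λ a b → a :* a :+ :- ((:- b) :* b) := a :* a :+ b :* b) refl

  -- ⟨Uψ|Uψ⟩ expands to a triple sum over the row x and two columns y, z. Moving the sum over x
  -- innermost turns it into the entry (y, z) of U†U, and the resulting delta leaves only z = y.
  inner-isometry : ∀ {U : Matrix n m w} → IsUnitary U → ∀ ψ → inner (U $ ψ) ≃ᶜ inner ψ
  inner-isometry {U} (U†U≈I , _) ψ = begin
    inner (U $ ψ)
      ≈⟨ Σᶜ.∑-cong B _ (λ x → sumᶜ B (A x) *ᶜ sumᶜ B (C x)) (λ x → Cˢ.*-congʳ (conj-$ x)) ⟩
    (sumᶜ B λ x → sumᶜ B (A x) *ᶜ sumᶜ B (C x))
      ≈⟨ Σᶜ.∑-cong B _ (λ x → sumᶜ B λ y → sumᶜ B λ z → A x y *ᶜ C x z) expand ⟩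
    (sumᶜ B λ x → sumᶜ B λ y → sumᶜ B λ z → A x y *ᶜ C x z)
      ≈⟨ Σᶜ.∑-swap B B (λ x y → sumᶜ B λ z → A x y *ᶜ C x z) ⟩
    (sumᶜ B λ y → sumᶜ B λ x → sumᶜ B λ z → A x y *ᶜ C x z)
      ≈⟨ Σᶜ.∑-cong B _ _ (λ y → Σᶜ.∑-swap B B (λ x z → A x y *ᶜ C x z)) ⟩
    (sumᶜ B λ y → sumᶜ B λ z → sumᶜ B λ x → A x y *ᶜ C x z)
      ≈⟨ Σᶜ.∑-cong B _ _ (λ y → Σᶜ.∑-cong B _ (λ z → ψψ y z *ᶜ I y z) (contract y)) ⟩
    (sumᶜ B λ y → sumᶜ B λ z → ψψ y z *ᶜ I y z)
      ≈⟨ Σᶜ.∑-cong B _ (λ y → ψψ y y) select ⟩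
    inner ψ ∎
    where
    open Relation.Binary.Reasoning.Setoid Cˢ.setoid
    B = basis n m w
    A C : Basis n m w → Basis n m w → ℂ
    A x y = conj (U x y) *ᶜ conj (ψ y)
    C x z = U x z *ᶜ ψ z
    ψψ : Basis n m w → Basis n m w → ℂ
    ψψ y z = conj (ψ y) *ᶜ ψ z

    conj-$ : ∀ x → conj ((U $ ψ) x) ≃ᶜ sumᶜ B (A x)
    conj-$ x = Cˢ.trans (conj-sumᶜ B (C x)) (Σᶜ.∑-cong B _ (A x) λ y → conj-* (U x y) (ψ y))

    expand : ∀ x → sumᶜ B (A x) *ᶜ sumᶜ B (C x) ≃ᶜ (sumᶜ B λ y → sumᶜ B λ z → A x y *ᶜ C x z)
    expand x = Cˢ.trans (Σᶜ.∑-*ʳ B (sumᶜ B (C x)) (A x))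
      (Σᶜ.∑-cong B _ _ λ y → Σᶜ.∑-*ˡ B (A x y) (C x))

    rearrange : ∀ a b c d → (a *ᶜ b) *ᶜ (c *ᶜ d) ≃ᶜ (b *ᶜ d) *ᶜ (a *ᶜ c)
    rearrange a b c d = begin
      (a *ᶜ b) *ᶜ (c *ᶜ d)  ≈⟨ Cˢ.*-congʳ (Cˢ.*-comm a b) ⟩
      (b *ᶜ a) *ᶜ (c *ᶜ d)  ≈⟨ Cˢ.*-congˡ (Cˢ.*-comm c d) ⟩
      (b *ᶜ a) *ᶜ (d *ᶜ c)  ≈⟨ Cˢ.*-assoc b a (d *ᶜ c) ⟩
      b *ᶜ (a *ᶜ (d *ᶜ c))  ≈⟨ Cˢ.*-congˡ (Cˢ.*-assoc a d c) ⟨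
      b *ᶜ ((a *ᶜ d) *ᶜ c)  ≈⟨ Cˢ.*-congˡ (Cˢ.*-congʳ (Cˢ.*-comm a d)) ⟩
      b *ᶜ ((d *ᶜ a) *ᶜ c)  ≈⟨ Cˢ.*-congˡ (Cˢ.*-assoc d a c) ⟩
      b *ᶜ (d *ᶜ (a *ᶜ c))  ≈⟨ Cˢ.*-assoc b d (a *ᶜ c) ⟨
      (b *ᶜ d) *ᶜ (a *ᶜ c)  ∎

    contract : ∀ y z → (sumᶜ B λ x → A x y *ᶜ C x z) ≃ᶜ ψψ y z *ᶜ I y z
    contract y z = begin
      (sumᶜ B λ x → A x y *ᶜ C x z)
        ≈⟨ Σᶜ.∑-cong B _ (λ x → ψψ y z *ᶜ (conj (U x y) *ᶜ U x z))
             (λ x → rearrange (conj (U x y)) (conj (ψ y)) (U x z) (ψ z)) ⟩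
      (sumᶜ B λ x → ψψ y z *ᶜ (conj (U x y) *ᶜ U x z))
        ≈⟨ Σᶜ.∑-*ˡ B (ψψ y z) (λ x → conj (U x y) *ᶜ U x z) ⟨
      ψψ y z *ᶜ ((U †) · U) y z
        ≈⟨ Cˢ.*-congˡ (mkᶜ (mk≃ (proj₁ (U†U≈I y z))) (mk≃ (proj₂ (U†U≈I y z)))) ⟩
      ψψ y z *ᶜ I y z ∎

    off-diagonal : ∀ y z → z ≢ y → ψψ y z *ᶜ I y z ≃ᶜ 0ᶜ
    off-diagonal y z z≢y with y ≟ᴮ z
    ... | yes y≡z = contradiction (sym y≡z) z≢y
    ... | no  _   = Cˢ.zeroʳ (ψψ y z)

    diagonal : ∀ y → ψψ y y *ᶜ I y y ≃ᶜ ψψ y y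
    diagonal y with y ≟ᴮ y
    ... | yes _   = Cˢ.*-identityʳ (ψψ y y)
    ... | no  y≢y = contradiction refl y≢y

    select : ∀ y → (sumᶜ B λ z → ψψ y z *ᶜ I y z) ≃ᶜ ψψ y y
    select y = Cˢ.trans
      (Σᶜ.∑-supported B (λ z → ψψ y z *ᶜ I y z) y (basis-unique n m w) (basis-complete y) (off-diagonal y))
      (diagonal y)

  isometry : ∀ {U : Matrix n m w} → IsUnitary U → ∀ ψ → ‖ U $ ψ ‖² ≃ ‖ ψ ‖²
  isometry {U} u ψ = ≃-trans (≃-sym (re-inner (U $ ψ))) (≃-trans (re≃ (inner-isometry u ψ)) (re-inner ψ))

  ‖ket‖² : ∀ (y : Basis n m w) → ‖ ∣ y ⟩ ‖² ≃ 1ᴿ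
  ‖ket‖² y = ≃-trans
    (Σᴿ.∑-supported (basis n m w) (λ x → ∣ ∣ y ⟩ x ∣²) y (basis-unique n m w) (basis-complete y) off)
    on
    where
    off : ∀ x → x ≢ y → ∣ ∣ y ⟩ x ∣² ≃ 0ᴿ
    off x x≢y with x ≟ᴮ y
    ... | yes x≡y = contradiction x≡y x≢y
    ... | no  _   = ≡⇒≃ λ _ → refl
    on : ∣ ∣ y ⟩ y ∣² ≃ 1ᴿ
    on with y ≟ᴮ y
    ... | yes _   = ≡⇒≃ λ _ → refl
    ... | no  y≢y = contradiction refl y≢y

  -- Instead of permuting the list, f (τ x) is written as a sum over y of f y times the indicator of
  -- y = τ x, and the two sums are exchanged. For fixed y the only contributing x is τ y, because τ
  -- is its own inverse.
  sum-involution : ∀ (τ : Basis n m w → Basis n m w) → (∀ x → τ (τ x) ≡ x) → ∀ (f : Basis n m w → ℝ) →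
                   sumᴿ (basis n m w) (λ x → f (τ x)) ≃ sumᴿ (basis n m w) f
  sum-involution τ ττ f = begin
    (sumᴿ B λ x → f (τ x))                ≈⟨ Σᴿ.∑-cong B _ _ (λ x → ≃-sym (inner-sum x)) ⟩
    (sumᴿ B λ x → sumᴿ B λ y → δ x y)     ≈⟨ Σᴿ.∑-swap B B δ ⟩
    (sumᴿ B λ y → sumᴿ B λ x → δ x y)     ≈⟨ Σᴿ.∑-cong B _ _ outer-sum ⟩
    sumᴿ B f                              ∎
    where
    open Relation.Binary.Reasoning.Setoid Rˢ.setoid
    B = basis n m w
    δ : Basis n m w → Basis n m w → ℝ
    δ x y = if ⌊ y ≟ᴮ τ x ⌋ then f y else 0ᴿ
    hit : ∀ x y → y ≡ τ x → δ x y ≃ f y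
    hit x y y≡τx with y ≟ᴮ τ x
    ... | yes _    = ≃-refl
    ... | no  y≢τx = contradiction y≡τx y≢τx
    miss : ∀ x y → y ≢ τ x → δ x y ≃ 0ᴿ
    miss x y y≢τx with y ≟ᴮ τ x
    ... | yes y≡τx = contradiction y≡τx y≢τx
    ... | no  _    = ≃-refl
    inner-sum : ∀ x → sumᴿ B (λ y → δ x y) ≃ f (τ x)
    inner-sum x = ≃-trans
      (Σᴿ.∑-supported B (λ y → δ x y) (τ x) (basis-unique n m w) (basis-complete (τ x)) (λ y → miss x y))
      (hit x (τ x) refl)
    outer-sum : ∀ y → sumᴿ B (λ x → δ x y) ≃ f y
    outer-sum y = ≃-trans
      (Σᴿ.∑-supported B (λ x → δ x y) (τ y) (basis-unique n m w) (basis-complete (τ y))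
        (λ x x≢τy → miss x y λ y≡τx → x≢τy (trans (sym (ττ x)) (cong τ (sym y≡τx)))))
      (hit (τ y) y (sym (ττ y)))

⊕-involutive : ∀ {m} (b e : Vec Bool m) → (b ⊕ e) ⊕ e ≡ b
⊕-involutive []      []      = refl
⊕-involutive (x ∷ b) (y ∷ e) = cong₂ _∷_ xor-involutive (⊕-involutive b e)
  where
  xor-involutive : (x xor y) xor y ≡ x
  xor-involutive = trans (Bool.xor-assoc x y y) (trans (cong (x xor_) (Bool.xor-same y)) (Bool.xor-identityʳ x))

-- A general mask e covers both the oracle of a string (`answers s`) and the position-independent
-- shift by one character.
translate : ∀ {n m w} → (Fin n → Vec Bool m) → Basis n m w → Basis n m w
translate e (j , b , z) = j , b ⊕ e j , z

translate-involutive : ∀ {n m w} (e : Fin n → Vec Bool m) (x : Basis n m w) → translate e (translate e x) ≡ x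
translate-involutive e (j , b , z) = cong (λ b → j , b , z) (⊕-involutive b (e j))

‖translate‖² : ∀ {n m w} (e : Fin n → Vec Bool m) (ψ : State n m w) → ‖ (λ x → ψ (translate e x)) ‖² ≃ ‖ ψ ‖²
‖translate‖² e ψ = sum-involution (translate e) (translate-involutive e) (λ x → ∣ ψ x ∣²)

answers : ∀ {n σ} → Str n σ → Fin n → Vec Bool (width σ)
answers {σ = σ} s j = encode σ (Vec.lookup s j)

-- Column y of the oracle matrix has its only 1 in row τ y. As τ is an involution, row x has its
-- only 1 in column τ x, so the oracle acts on amplitudes by precomposition with τ.
oracle-$ : ∀ {n σ w} (s : Str n σ) (ψ : State n (width σ) w) x →
           (oracle {σ = σ} s $ ψ) x ≃ᶜ ψ (translate (answers s) x)
oracle-$ {n} {σ} {w} s ψ x = Cˢ.trans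
  (Σᶜ.∑-supported (basis n (width σ) w) (λ y → oracle {σ = σ} s x y *ᶜ ψ y) (τ x)
    (basis-unique n (width σ) w) (basis-complete (τ x)) off)
  on
  where
  τ = translate {w = w} (answers s)
  off : ∀ y → y ≢ τ x → oracle {σ = σ} s x y *ᶜ ψ y ≃ᶜ 0ᶜ
  off y y≢τx with x ≟ᴮ τ y
  ... | yes x≡τy = contradiction (trans (sym (translate-involutive (answers s) y)) (cong τ (sym x≡τy))) y≢τx
  ... | no  _    = Cˢ.zeroˡ (ψ y)
  on : oracle {σ = σ} s x (τ x) *ᶜ ψ (τ x) ≃ᶜ ψ (τ x)
  on with x ≟ᴮ τ (τ x)
  ... | yes _    = Cˢ.*-identityˡ (ψ (τ x))
  ... | no  x≢ττx = contradiction (sym (translate-involutive (answers s) x)) x≢ττx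

‖oracle‖² : ∀ {n σ w} (s : Str n σ) (ψ : State n (width σ) w) → ‖ oracle {σ = σ} s $ ψ ‖² ≃ ‖ ψ ‖²
‖oracle‖² {σ = σ} s ψ = ≃-trans
  (‖‖²-cong (oracle {σ = σ} s $ ψ) (λ x → ψ (translate (answers s) x)) (oracle-$ s ψ))
  (‖translate‖² (answers s) ψ)

-- Naturals inside the rationals, and the recurrence for the distance.

ι : ℕ → ℚ
ι n = + n ℚ./ 1

ιᵘ : ℕ → ℚᵘ.ℚᵘ
ιᵘ n = ℚᵘ.mkℚᵘ (+ n) 0

-- The division in `ι` normalises by a gcd, which is stuck on a variable n; facts about `ι` are
-- therefore checked on unnormalised fractions.
toℚᵘ-ι : ∀ n → ℚ.toℚᵘ (ι n) ℚᵘ.≃ ιᵘ n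
toℚᵘ-ι n = ℚ.toℚᵘ-fromℚᵘ (ιᵘ n)

ι-+ : ∀ m n → ι (m ℕ.+ n) ≡ ι m ℚ.+ ι n
ι-+ m n = ℚ.toℚᵘ-injective (ℚᵘ.≃-trans (toℚᵘ-ι (m ℕ.+ n)) (ℚᵘ.≃-trans eq (ℚᵘ.≃-sym
  (ℚᵘ.≃-trans (ℚ.toℚᵘ-homo-+ (ι m) (ι n)) (ℚᵘ.+-cong (toℚᵘ-ι m) (toℚᵘ-ι n))))))
  where
  eq : ιᵘ (m ℕ.+ n) ℚᵘ.≃ ιᵘ m ℚᵘ.+ ιᵘ n
  eq = ℚᵘ.*≡* (cong (ℤ._* + 1) (trans (ℤ.pos-+ m n)
    (cong₂ ℤ._+_ (sym (ℤ.*-identityʳ (+ m))) (sym (ℤ.*-identityʳ (+ n))))))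

ι-* : ∀ m n → ι (m ℕ.* n) ≡ ι m ℚ.* ι n
ι-* m n = ℚ.toℚᵘ-injective (ℚᵘ.≃-trans (toℚᵘ-ι (m ℕ.* n)) (ℚᵘ.≃-trans eq (ℚᵘ.≃-sym
  (ℚᵘ.≃-trans (ℚ.toℚᵘ-homo-* (ι m) (ι n)) (ℚᵘ.*-cong (toℚᵘ-ι m) (toℚᵘ-ι n))))))
  where
  eq : ιᵘ (m ℕ.* n) ℚᵘ.≃ ιᵘ m ℚᵘ.* ιᵘ n
  eq = ℚᵘ.*≡* (cong (ℤ._* + 1) (ℤ.pos-* m n))

ι-cancel-≤ : ∀ {m n} → ι m ℚ.≤ ι n → m ℕ.≤ n
ι-cancel-≤ {m} {n} p
  with ℚᵘ.≤-respˡ-≃ (toℚᵘ-ι m) (ℚᵘ.≤-respʳ-≃ (toℚᵘ-ι n) (ℚ.toℚᵘ-mono-≤ p))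
... | ℚᵘ.*≤* q = ℤ.drop‿+≤+ (subst₂ ℤ._≤_ (ℤ.*-identityʳ (+ m)) (ℤ.*-identityʳ (+ n)) q)

ι-pos : ∀ n → 0ℚ ℚ.< ι (suc n)
ι-pos n = ℚ.toℚᵘ-cancel-< (ℚᵘ.<-respʳ-≃ (ℚᵘ.≃-sym (toℚᵘ-ι (suc n))) (ℚᵘ.positive⁻¹ (ιᵘ (suc n))))

4ℚ : ℚ
4ℚ = 2ℚ ℚ.+ 2ℚ

-- 4 (t + 1)² rather than 4 t²: the AM–GM weights 1/(t+1) and t+1 then exist at t = 0.

distanceBound : ℕ → ℚ
distanceBound t = 4ℚ ℚ.* (ι (suc t) ℚ.* ι (suc t))

-- With q = t + 1 and r = 1/q the left side is 4q² + 4q + 4 + 4q = 4 (q + 1)², so these weights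
-- reproduce the bound without loss.
distanceBound-step : ∀ t r → r ℚ.* ι (suc t) ≡ 1ℚ →
  (1ℚ ℚ.+ r) ℚ.* distanceBound t ℚ.+ (1ℚ ℚ.+ ι (suc t)) ℚ.* 4ℚ ≡ distanceBound (suc t)
distanceBound-step t r rq≡1 = trans (expand r q 4ℚ) (trans (cong expanded rq≡1)
  (trans (collect q 4ℚ) (cong (λ q → 4ℚ ℚ.* (q ℚ.* q)) (sym (ι-+ 1 (suc t))))))
  where
  q = ι (suc t)
  -- The product r q is abstracted as k so that it can be replaced by 1 between two purely
  -- polynomial identities.
  expanded : ℚ → ℚ
  expanded k = 4ℚ ℚ.* (q ℚ.* q) ℚ.+ k ℚ.* (4ℚ ℚ.* q) ℚ.+ (1ℚ ℚ.+ q) ℚ.* 4ℚ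
  open ℚSolver
  expand = solve 3 (λ r q f → (con 1ℚ :+ r) :* (f :* (q :* q)) :+ (con 1ℚ :+ q) :* f :=
    f :* (q :* q) :+ (r :* q) :* (f :* q) :+ (con 1ℚ :+ q) :* f) refl
  collect = solve 2 (λ q f → f :* (q :* q) :+ con 1ℚ :* (f :* q) :+ (con 1ℚ :+ q) :* f :=
    f :* ((con 1ℚ :+ q) :* (con 1ℚ :+ q))) refl

-- The hybrid argument for strings with one marked position.

marked : ∀ {n σ} → Fin σ → Fin σ → Fin n → Str n σ
marked c₀ c₁ i = Vec.replicate _ c₀ [ i ]≔ c₁

lookup-marked : ∀ {n σ} (c₀ c₁ : Fin σ) (i : Fin n) → Vec.lookup (marked c₀ c₁ i) i ≡ c₁
lookup-marked c₀ c₁ i = Vec.lookup∘update i (Vec.replicate _ c₀) c₁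

lookup-marked′ : ∀ {n σ} (c₀ c₁ : Fin σ) {i j : Fin n} → j ≢ i → Vec.lookup (marked c₀ c₁ i) j ≡ c₀
lookup-marked′ c₀ c₁ {j = j} j≢i =
  trans (Vec.lookup∘update′ j≢i (Vec.replicate _ c₀) c₁) (Vec.lookup-replicate j c₀)

module Hybrid {n σ w : ℕ} (c₀ c₁ : Fin σ) where

  m : ℕ
  m = width σ

  S : Set
  S = State n m w

  base : Str n σ
  base = Vec.replicate n c₀

  round : Str n σ → S → Unitary n m w → S
  round s ψ U = matrix U $ (oracle {σ = σ} s $ ψ)

  shift : Fin σ → Basis n m w → Basis n m w
  shift c = translate λ _ → encode σ c

  -- The change in the answer to a query if all positions were overwritten by `c₁` at once.
  -- `jump ψ i` is its restriction to the basis states that query i.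
  kick : S → Basis n m w → ℂ
  kick ψ x = ψ (shift c₁ x) +ᶜ (-ᶜ ψ (shift c₀ x))

  -- (O_{marked i} − O_{base}) ψ
  jump : S → Fin n → S
  jump ψ i x = if ⌊ proj₁ x Fin.≟ i ⌋ then kick ψ x else 0ᶜ

  oracle-marked : ∀ ψ i x →
    (oracle {σ = σ} (marked c₀ c₁ i) $ ψ) x ≃ᶜ (oracle {σ = σ} base $ ψ) x +ᶜ jump ψ i x
  oracle-marked ψ i x@(j , b , z) = begin
    (oracle {σ = σ} (marked c₀ c₁ i) $ ψ) x
      ≈⟨ oracle-$ (marked c₀ c₁ i) ψ x ⟩
    ψ (j , b ⊕ encode σ (Vec.lookup (marked c₀ c₁ i) j) , z)
      ≈⟨ local ⟩
    ψ (shift c₀ x) +ᶜ jump ψ i x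
      ≡⟨ cong (λ c → ψ (j , b ⊕ encode σ c , z) +ᶜ jump ψ i x) (Vec.lookup-replicate j c₀) ⟨
    ψ (translate (answers base) x) +ᶜ jump ψ i x
      ≈⟨ Cˢ.+-congʳ (oracle-$ base ψ x) ⟨
    (oracle {σ = σ} base $ ψ) x +ᶜ jump ψ i x ∎
    where
    open Relation.Binary.Reasoning.Setoid Cˢ.setoid
    cancel : ∀ u v → u ≃ᶜ v +ᶜ (u +ᶜ (-ᶜ v))
    cancel u v = ≡⇒≃ᶜ (λ k → eq (seq (re u) k) (seq (re v) k)) (λ k → eq (seq (im u) k) (seq (im v) k))
      where
      open ℚSolver
      eq = solve 2 (λ a b → a := b :+ (a :+ :- b)) refl
    local : ψ (j , b ⊕ encode σ (Vec.lookup (marked c₀ c₁ i) j) , z) ≃ᶜ ψ (shift c₀ x) +ᶜ jump ψ i x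
    local with j Fin.≟ i
    ... | yes refl rewrite lookup-marked c₀ c₁ i = cancel (ψ (shift c₁ x)) (ψ (shift c₀ x))
    ... | no  j≢i  rewrite lookup-marked′ c₀ c₁ j≢i = Cˢ.sym (Cˢ.+-identityʳ (ψ (shift c₀ x)))

  ∑-jump : ∀ ψ x → sumᴿ (allFin n) (λ i → ∣ jump ψ i x ∣²) ≃ ∣ kick ψ x ∣²
  ∑-jump ψ x = ≃-trans
    (Σᴿ.∑-supported (allFin n) (λ i → ∣ jump ψ i x ∣²) (proj₁ x) (Unique.allFin⁺ n) (∈-allFin (proj₁ x)) off)
    on
    where
    off : ∀ i → i ≢ proj₁ x → ∣ jump ψ i x ∣² ≃ 0ᴿ
    off i i≢j with proj₁ x Fin.≟ i
    ... | yes j≡i = contradiction (sym j≡i) i≢j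
    ... | no  _   = ≡⇒≃ λ _ → refl
    on : ∣ jump ψ (proj₁ x) x ∣² ≃ ∣ kick ψ x ∣²
    on with proj₁ x Fin.≟ proj₁ x
    ... | yes _   = ≃-refl
    ... | no  j≢j = contradiction refl j≢j

  -- A difference of two norm-preserving translates of ψ, estimated with equal weights r = s = 1.
  -- The factor 4 in `distanceBound` originates here.
  ‖kick‖² : ∀ ψ → ‖ kick ψ ‖² ≲ fromℚ 2ℚ *ᴿ ‖ ψ ‖² +ᴿ fromℚ 2ℚ *ᴿ ‖ ψ ‖²
  ‖kick‖² ψ = ≲-trans
    (‖+‖²-≲ 1ℚ 1ℚ (λ x → ψ (shift c₁ x)) (λ x → -ᶜ ψ (shift c₀ x)) (ℚ.positive⁻¹ 1ℚ) refl)
    (≃⇒≲ (+ᴿ-cong (*ᴿ-congˡ (fromℚ 2ℚ) (‖translate‖² (λ _ → encode σ c₁) ψ))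
      (*ᴿ-congˡ (fromℚ 2ℚ) (≃-trans
        (Σᴿ.∑-cong (basis n m w) _ (λ x → ∣ ψ (shift c₀ x) ∣²) (λ x → ∣-∣² (ψ (shift c₀ x))))
        (‖translate‖² (λ _ → encode σ c₀) ψ)))))

  -- A basis state queries a single position, so the jumps for distinct i have
  -- disjoint supports: this is what saves the factor n.
  ‖jumps‖² : ∀ ψ → ‖ ψ ‖² ≲ 1ᴿ → sumᴿ (allFin n) (λ i → ‖ jump ψ i ‖²) ≲ fromℚ 4ℚ
  ‖jumps‖² ψ ψ≲1 = ≲-respˡ
    (≃-trans (Σᴿ.∑-swap (allFin n) (basis n m w) (λ i x → ∣ jump ψ i x ∣²))
             (Σᴿ.∑-cong (basis n m w) _ (λ x → ∣ kick ψ x ∣²) (∑-jump ψ)))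
    (≲-trans (‖kick‖² ψ) (≲-respʳ 2+2≃4 (+ᴿ-mono 2‖ψ‖² 2‖ψ‖²)))
    where
    2+2≃4 : fromℚ 2ℚ +ᴿ fromℚ 2ℚ ≃ fromℚ 4ℚ
    2+2≃4 = ≡⇒≃ λ _ → refl
    2‖ψ‖² : fromℚ 2ℚ *ᴿ ‖ ψ ‖² ≲ fromℚ 2ℚ
    2‖ψ‖² = ≲-respʳ (Rˢ.*-identityʳ (fromℚ 2ℚ)) (scale-mono 2ℚ (ℚ.positive⁻¹ 2ℚ) ψ≲1)

  -- The invariant after t queries. The bound is on the sum over all i, since a single marked run
  -- may well deviate a lot; `bounded₁` is what lets the next query apply `‖jumps‖²` to χ.
  record Close (t : ℕ) (χ : S) (χs : Fin n → S) : Set where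
    field
      deviation : Fin n → S
      split     : ∀ i x → χs i x ≃ᶜ χ x +ᶜ deviation i x
      bounded₁  : ‖ χ ‖² ≲ 1ᴿ
      distance  : sumᴿ (allFin n) (λ i → ‖ deviation i ‖²) ≲ fromℚ (distanceBound t)

  -- Writing δᵢ for the deviation, Oᵢ (χ + δᵢ) = O χ + (Oᵢ δᵢ + jumpᵢ χ), with O the oracle of
  -- `base`. The old deviation is only moved isometrically, and the new error depends on χ alone, so
  -- the errors for all i come from one state.
  round-close : ∀ {t χ χs} U → Close t χ χs →
                Close (suc t) (round base χ U) (λ i → round (marked c₀ c₁ i) (χs i) U)
  round-close {t} {χ} {χs} U close = record
    { deviation = λ i → matrix U $ drift i
    ; split     = λ i x → begin
        (matrix U $ (O i $ χs i)) x
          ≈⟨ $-cong (matrix U) _ (λ y → (Oᵇ $ χ) y +ᶜ drift i y) (split′ i) x ⟩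
        (matrix U $ (λ y → (Oᵇ $ χ) y +ᶜ drift i y)) x
          ≈⟨ $-+ (matrix U) (Oᵇ $ χ) (drift i) x ⟩
        (matrix U $ (Oᵇ $ χ)) x +ᶜ (matrix U $ drift i) x ∎
    ; bounded₁  = ≲-respˡ (≃-trans (isometry (isUnitary U) (Oᵇ $ χ)) (‖oracle‖² base χ)) bounded₁
    ; distance  = ≲-respˡ
        (Σᴿ.∑-cong (allFin n) _ (λ i → ‖ drift i ‖²) (λ i → isometry (isUnitary U) (drift i)))
        (≲-trans
          (sumᴿ-mono (allFin n) (λ i → ‖ drift i ‖²)
            (λ i → fromℚ (1ℚ ℚ.+ r) *ᴿ ‖ deviation i ‖² +ᴿ fromℚ (1ℚ ℚ.+ q) *ᴿ ‖ jump χ i ‖²)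
            drift-bound)
          (≲-respˡ
            (sumᴿ-linear (allFin n) (fromℚ (1ℚ ℚ.+ r)) (fromℚ (1ℚ ℚ.+ q))
              (λ i → ‖ deviation i ‖²) (λ i → ‖ jump χ i ‖²))
            (≲-respʳ (≡⇒≃ λ _ → distanceBound-step t r rq≡1)
              (+ᴿ-mono (scale-mono (1ℚ ℚ.+ r) (1+-pos 0<r) distance)
                       (scale-mono (1ℚ ℚ.+ q) (1+-pos 0<q) (‖jumps‖² χ bounded₁))))))
    }
    where
    open Close close
    open Relation.Binary.Reasoning.Setoid Cˢ.setoid
    -- The AM-GM weights: the accumulated deviation gets the factor 1 + 1/(t + 1), the fresh jump
    -- the factor 1 + (t + 1).
    q = ι (suc t)
    0<q = ι-pos t
    q⁻¹ = quotient q 1ℚ 0<q (ℚ.positive⁻¹ 1ℚ)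
    r = proj₁ q⁻¹
    0<r = proj₁ (proj₂ q⁻¹)
    rq≡1 : r ℚ.* q ≡ 1ℚ
    rq≡1 = trans (ℚ.*-comm r q) (proj₂ (proj₂ q⁻¹))
    1+-pos : ∀ {p} → 0ℚ ℚ.< p → 0ℚ ℚ.< 1ℚ ℚ.+ p
    1+-pos 0<p = ℚ.+-mono-< (ℚ.positive⁻¹ 1ℚ) 0<p
    O : Fin n → Matrix n m w
    O i = oracle {σ = σ} (marked c₀ c₁ i)
    Oᵇ : Matrix n m w
    Oᵇ = oracle {σ = σ} base
    drift : Fin n → S
    drift i x = (O i $ deviation i) x +ᶜ jump χ i x

    split′ : ∀ i x → (O i $ χs i) x ≃ᶜ (Oᵇ $ χ) x +ᶜ drift i x
    split′ i x = begin
      (O i $ χs i) x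
        ≈⟨ $-cong (O i) (χs i) (λ y → χ y +ᶜ deviation i y) (split i) x ⟩
      (O i $ (λ y → χ y +ᶜ deviation i y)) x
        ≈⟨ $-+ (O i) χ (deviation i) x ⟩
      (O i $ χ) x +ᶜ (O i $ deviation i) x
        ≈⟨ Cˢ.+-congʳ (oracle-marked χ i x) ⟩
      ((Oᵇ $ χ) x +ᶜ jump χ i x) +ᶜ (O i $ deviation i) x
        ≈⟨ Cˢ.+-assoc _ _ _ ⟩
      (Oᵇ $ χ) x +ᶜ (jump χ i x +ᶜ (O i $ deviation i) x)
        ≈⟨ Cˢ.+-congˡ (Cˢ.+-comm _ _) ⟩
      (Oᵇ $ χ) x +ᶜ drift i x ∎

    drift-bound : ∀ i → ‖ drift i ‖² ≲
      fromℚ (1ℚ ℚ.+ r) *ᴿ ‖ deviation i ‖² +ᴿ fromℚ (1ℚ ℚ.+ q) *ᴿ ‖ jump χ i ‖²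
    drift-bound i = ≲-respʳ
      (+ᴿ-cong (*ᴿ-congˡ (fromℚ (1ℚ ℚ.+ r)) (‖oracle‖² (marked c₀ c₁ i) (deviation i))) ≃-refl)
      (‖+‖²-≲ r q (O i $ deviation i) (jump χ i) 0<r rq≡1)

  -- The same fold as in `finalState`, so the two agree by computation; the initial state is a
  -- parameter because a left fold changes it at each induction step.
  run : ∀ {T} → Str n σ → S → Vec (Unitary n m w) T → S
  run s = Vec.foldl (λ _ → S) (round s)

  run-close : ∀ {T t χ χs} (Us : Vec (Unitary n m w) T) → Close t χ χs →
              Close (T ℕ.+ t) (run base χ Us) (λ i → run (marked c₀ c₁ i) (χs i) Us)
  run-close [] close = close
  run-close {suc T} {t} {χ} {χs} (U ∷ Us) close = subst
    (λ k → Close k (run base (round base χ U) Us)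
                   (λ i → run (marked c₀ c₁ i) (round (marked c₀ c₁ i) (χs i) U) Us))
    (ℕ.+-suc T t) (run-close Us (round-close U close))

  start-close : ∀ χ → ‖ χ ‖² ≃ 1ᴿ → Close 0 χ (λ _ → χ)
  start-close χ ‖χ‖²≃1 = record
    { deviation = λ _ _ → 0ᶜ
    ; split     = λ i x → Cˢ.sym (Cˢ.+-identityʳ (χ x))
    ; bounded₁  = ≃⇒≲ ‖χ‖²≃1
    ; distance  = ≲-respˡ
        (≃-trans (Σᴿ.∑-cong (allFin n) _ (λ _ → 0ᴿ) λ _ →
                   ≃-trans (Σᴿ.∑-cong (basis n m w) (λ _ → ∣ 0ᶜ ∣²) (λ _ → 0ᴿ) λ _ → ≡⇒≃ λ _ → refl)
                           (Σᴿ.∑-zero (basis n m w)))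
                 (Σᴿ.∑-zero (allFin n)))
        (≤⇒≲ λ _ → ℚ.nonNegative⁻¹ (distanceBound 0))
    }

-- From success probabilities to an inequality between n and T.

sumᴿ-const : ∀ {A : Set} (xs : List A) q → sumᴿ xs (λ _ → fromℚ q) ≃ fromℚ (ι (length xs) ℚ.* q)
sumᴿ-const []       q = ≡⇒≃ λ _ → sym (ℚ.*-zeroˡ q)
sumᴿ-const (x ∷ xs) q = ≃-trans (+ᴿ-cong ≃-refl (sumᴿ-const xs q)) (≡⇒≃ λ _ →
  trans (cong (ℚ._+ ι (length xs) ℚ.* q) (sym (ℚ.*-identityˡ q)))
    (trans (sym (ℚ.*-distribʳ-+ q 1ℚ (ι (length xs)))) (cong (ℚ._* q) (sym (ι-+ 1 (length xs))))))

2/3 : ℚ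
2/3 = + 2 ℚ./ 3

module _ {n σ T : ℕ} (A : QueryAlgorithm n σ T) (c₀ c₁ : Fin σ) where

  open QueryAlgorithm A
  open Hybrid {n} {σ} {workspace} c₀ c₁

  -- The probability of reporting i, for an arbitrary state and in indicator form, so that it can be
  -- summed over i.
  hit : S → Fin n → ℝ
  hit ψ i = sumᴿ (basis n m workspace) λ x → if ⌊ output x Fin.≟ i ⌋ then ∣ ψ x ∣² else 0ᴿ

  -- Each measurement outcome is reported as exactly one position, so the events for distinct i
  -- partition the basis. This caps the total contribution of the unmarked run.
  ∑-hit : ∀ ψ → sumᴿ (allFin n) (hit ψ) ≃ ‖ ψ ‖²
  ∑-hit ψ = ≃-trans
    (Σᴿ.∑-swap (allFin n) (basis n m workspace)
      (λ i x → if ⌊ output x Fin.≟ i ⌋ then ∣ ψ x ∣² else 0ᴿ))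
    (Σᴿ.∑-cong (basis n m workspace) _ (λ x → ∣ ψ x ∣²) λ x → ≃-trans
      (Σᴿ.∑-supported (allFin n) (λ i → if ⌊ output x Fin.≟ i ⌋ then ∣ ψ x ∣² else 0ᴿ) (output x)
        (Unique.allFin⁺ n) (∈-allFin (output x)) (off x))
      (on x))
    where
    off : ∀ x i → i ≢ output x → (if ⌊ output x Fin.≟ i ⌋ then ∣ ψ x ∣² else 0ᴿ) ≃ 0ᴿ
    off x i i≢o with output x Fin.≟ i
    ... | yes o≡i = contradiction (sym o≡i) i≢o
    ... | no  _   = ≃-refl
    on : ∀ x → (if ⌊ output x Fin.≟ output x ⌋ then ∣ ψ x ∣² else 0ᴿ) ≃ ∣ ψ x ∣²
    on x with output x Fin.≟ output x
    ... | yes _   = ≃-refl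
    ... | no  o≢o = contradiction refl o≢o

  hit-split : ∀ (ψ χ φ : S) → (∀ x → ψ x ≃ᶜ χ x +ᶜ φ x) → ∀ i →
              hit ψ i ≲ fromℚ 2ℚ *ᴿ hit χ i +ᴿ fromℚ 2ℚ *ᴿ ‖ φ ‖²
  hit-split ψ χ φ split i = ≲-respʳ
    (sumᴿ-linear (basis n m workspace) (fromℚ 2ℚ) (fromℚ 2ℚ)
      (λ x → if ⌊ output x Fin.≟ i ⌋ then ∣ χ x ∣² else 0ᴿ) (λ x → ∣ φ x ∣²))
    (sumᴿ-mono (basis n m workspace) _ _ pointwise)
    where
    pointwise : ∀ x → (if ⌊ output x Fin.≟ i ⌋ then ∣ ψ x ∣² else 0ᴿ) ≲
      fromℚ 2ℚ *ᴿ (if ⌊ output x Fin.≟ i ⌋ then ∣ χ x ∣² else 0ᴿ) +ᴿ fromℚ 2ℚ *ᴿ ∣ φ x ∣²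
    pointwise x with output x Fin.≟ i
    ... | yes _ = ≲-respˡ (∣∣²-cong (split x)) (∣+∣²-≲-2 (χ x) (φ x))
    -- Outcomes not reported as i contribute 0 on the left, but the full norm of φ on the right
    -- counts them too; nonnegativity absorbs this.
    ... | no  _ = ≲-respˡ zero≃ (+ᴿ-mono ≲-refl (scale-mono 2ℚ (ℚ.positive⁻¹ 2ℚ) (∣∣²-nonneg (φ x))))
      where
      zero≃ : 0ᴿ ≃ fromℚ 2ℚ *ᴿ 0ᴿ +ᴿ fromℚ 2ℚ *ᴿ 0ᴿ
      zero≃ = ≡⇒≃ λ _ → refl

  Pr≃hit : ∀ s i → Pr[ s outputs i ] ≃ hit (finalState s) i
  Pr≃hit s i = Σᴿ.∑-filter (λ x → output x Fin.≟ i) (basis n m workspace) (λ x → ∣ finalState s x ∣²)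

  hits-bound : ∀ {t χ χs} → Close t χ χs → (∀ i → fromℚ 2/3 ≲ hit (χs i) i) →
               ι n ℚ.* 2/3 ℚ.≤ 2ℚ ℚ.* 1ℚ ℚ.+ 2ℚ ℚ.* distanceBound t
  hits-bound {t} {χ} {χs} close hits = fromℚ-cancel-≲ (≲-respˡ total (≲-trans
    (sumᴿ-mono (allFin n) (λ _ → fromℚ 2/3)
      (λ i → fromℚ 2ℚ *ᴿ hit χ i +ᴿ fromℚ 2ℚ *ᴿ ‖ deviation i ‖²)
      (λ i → ≲-trans (hits i) (hit-split (χs i) χ (deviation i) (split i) i)))
    (≲-respˡ (sumᴿ-linear (allFin n) (fromℚ 2ℚ) (fromℚ 2ℚ) (hit χ) (λ i → ‖ deviation i ‖²))
      (≲-respʳ final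
        (+ᴿ-mono (scale-mono 2ℚ (ℚ.positive⁻¹ 2ℚ) (≲-respˡ (∑-hit χ) bounded₁))
                 (scale-mono 2ℚ (ℚ.positive⁻¹ 2ℚ) distance))))))
    where
    open Close close
    total : fromℚ (ι n ℚ.* 2/3) ≃ sumᴿ (allFin n) (λ _ → fromℚ 2/3)
    total = ≃-sym (≃-trans (sumᴿ-const (allFin n) 2/3)
      (≡⇒≃ λ _ → cong (λ k → ι k ℚ.* 2/3) (List.length-tabulate {n = n} (λ i → i))))
    final : fromℚ 2ℚ *ᴿ 1ᴿ +ᴿ fromℚ 2ℚ *ᴿ fromℚ (distanceBound t)
            ≃ fromℚ (2ℚ ℚ.* 1ℚ ℚ.+ 2ℚ ℚ.* distanceBound t)
    final = ≡⇒≃ λ _ → refl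

  finalState-close : Close T (finalState base) (λ i → finalState (marked c₀ c₁ i))
  finalState-close = subst (λ k → Close k (finalState base) (λ i → finalState (marked c₀ c₁ i)))
    (ℕ.+-identityʳ T) (run-close Us (start-close (matrix U₀ $ ∣ start ⟩)
      (≃-trans (isometry (isUnitary U₀) ∣ start ⟩) (‖ket‖² start))))

  success-bound : (∀ i → fromℚ 2/3 ≤ᴿ Pr[ marked c₀ c₁ i outputs i ]) →
                  ι n ℚ.* 2/3 ℚ.≤ 2ℚ ℚ.* 1ℚ ℚ.+ 2ℚ ℚ.* distanceBound T
  success-bound success = hits-bound finalState-close λ i →
    ≲-respʳ (Pr≃hit (marked c₀ c₁ i) i) (mk≲ (success i))

-- The constants, and comparison with √n.

clear-denominators : ∀ n T → ι n ℚ.* 2/3 ℚ.≤ 2ℚ ℚ.* 1ℚ ℚ.+ 2ℚ ℚ.* distanceBound T →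
                     n ℕ.* 2 ℕ.≤ 6 ℕ.+ 24 ℕ.* (suc T ℕ.* suc T)
clear-denominators n T p = ι-cancel-≤ (subst₂ ℚ._≤_ left right
  (ℚ.*-monoˡ-≤-nonNeg (ι 3) p))
  where
  open ℚSolver
  q = ι (suc T)
  left : ι 3 ℚ.* (ι n ℚ.* 2/3) ≡ ι (n ℕ.* 2)
  left = trans (solve 1 (λ x → con (ι 3) :* (x :* con 2/3) := x :* con (ι 2)) refl (ι n)) (sym (ι-* n 2))
  right : ι 3 ℚ.* (2ℚ ℚ.* 1ℚ ℚ.+ 2ℚ ℚ.* distanceBound T) ≡ ι (6 ℕ.+ 24 ℕ.* (suc T ℕ.* suc T))
  right = trans
    (solve 1 (λ y → con (ι 3) :* (con 2ℚ :* con 1ℚ :+ con 2ℚ :* (con 4ℚ :* y)) := con (ι 6) :+ con (ι 24) :* y)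
      refl (q ℚ.* q))
    (sym (trans (ι-+ 6 (24 ℕ.* (suc T ℕ.* suc T)))
      (cong (ι 6 ℚ.+_) (trans (ι-* 24 (suc T ℕ.* suc T)) (cong (ι 24 ℚ.*_) (ι-* (suc T) (suc T)))))))

quadratic-bound : ∀ n T → 16 ℕ.≤ n → n ℕ.* 2 ℕ.≤ 6 ℕ.+ 24 ℕ.* (suc T ℕ.* suc T) →
                  n ℕ.≤ (8 ℕ.* T) ℕ.* (8 ℕ.* T)
quadratic-bound n zero 16≤n p =
  -- Without queries the bound reads 2n ≤ 30, while n ≥ 16 gives 2n ≥ 32. This is the origin of the
  -- threshold 16.
  contradiction (ℕ.≤-trans (ℕ.*-monoˡ-≤ 2 16≤n) p) (ℕ.<⇒≱ (ℕ.n<1+n 30) ∘ ℕ.≤-trans (ℕ.n≤1+n 31))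
quadratic-bound n (suc k) _ p = ℕ.*-cancelʳ-≤ n _ 2 (begin
  n ℕ.* 2
    ≤⟨ p ⟩
  6 ℕ.+ 24 ℕ.* (suc (suc k) ℕ.* suc (suc k))
    -- The added polynomial is the slack 128 T² - 24 (T + 1)² - 6 at T = k + 1; its coefficients are
    -- all nonnegative.
    ≤⟨ ℕ.m≤m+n _ (104 ℕ.* (k ℕ.* k) ℕ.+ 160 ℕ.* k ℕ.+ 26) ⟩
  6 ℕ.+ 24 ℕ.* (suc (suc k) ℕ.* suc (suc k)) ℕ.+ (104 ℕ.* (k ℕ.* k) ℕ.+ 160 ℕ.* k ℕ.+ 26)
    ≡⟨ eq k ⟩
  (8 ℕ.* suc k) ℕ.* (8 ℕ.* suc k) ℕ.* 2 ∎)
  where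
  open ℕ.≤-Reasoning
  open ℕSolver
  eq : ∀ k → 6 ℕ.+ 24 ℕ.* (suc (suc k) ℕ.* suc (suc k)) ℕ.+ (104 ℕ.* (k ℕ.* k) ℕ.+ 160 ℕ.* k ℕ.+ 26)
           ≡ (8 ℕ.* suc k) ℕ.* (8 ℕ.* suc k) ℕ.* 2
  eq = solve 1 (λ k →
    con 6 :+ con 24 :* ((con 2 :+ k) :* (con 2 :+ k)) :+ (con 104 :* (k :* k) :+ con 160 :* k :+ con 26)
    := (con 8 :* (con 1 :+ k)) :* (con 8 :* (con 1 :+ k)) :* con 2) refl

isqrt-≤ : ∀ {n r} → n ℕ.≤ r ℕ.* r → isqrt n ℕ.≤ r
isqrt-≤ {n} n≤r² = ℕ.≮⇒≥ λ r<√n →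
  ℕ.<⇒≱ (ℕ.*-mono-< r<√n r<√n) (ℕ.≤-trans (isqrt-lower n) n≤r²)

√-seq-≤ : ∀ {n r} → n ℕ.≤ r ℕ.* r → ∀ k → √-seq n k ℚ.≤ ι r
√-seq-≤ {n} {r} n≤r² k = ℚ.toℚᵘ-cancel-≤
  (ℚᵘ.≤-respˡ-≃ (ℚᵘ.≃-sym (ℚ.toℚᵘ-fromℚᵘ (ℚᵘ.mkℚᵘ (+ a) k)))
    (ℚᵘ.≤-respʳ-≃ (ℚᵘ.≃-sym (toℚᵘ-ι r))
      (ℚᵘ.*≤* (subst₂ ℤ._≤_ (sym (ℤ.*-identityʳ (+ a))) (ℤ.pos-* r (suc k)) (ℤ.+≤+ (isqrt-≤ le))))))
  where
  a = isqrt (n ℕ.* (suc k ℕ.* suc k))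
  le : n ℕ.* (suc k ℕ.* suc k) ℕ.≤ (r ℕ.* suc k) ℕ.* (r ℕ.* suc k)
  le = ℕ.≤-trans (ℕ.*-monoˡ-≤ (suc k ℕ.* suc k) n≤r²)
    (ℕ.≤-reflexive (eq r (suc k)))
    where
    open ℕSolver
    eq : ∀ r k → (r ℕ.* r) ℕ.* (k ℕ.* k) ≡ (r ℕ.* k) ℕ.* (r ℕ.* k)
    eq = solve 2 (λ r k → (r :* r) :* (k :* k) := (r :* k) :* (r :* k)) refl

1/8 : ℚ
1/8 = + 1 ℚ./ 8

√n≤8T : ∀ {n T} → n ℕ.≤ (8 ℕ.* T) ℕ.* (8 ℕ.* T) → fromℚ 1/8 *ᴿ √ n ≤ᴿ fromℕ T
√n≤8T {n} {T} p = get≲ (≤⇒≲ {fromℚ 1/8 *ᴿ √ n} {fromℕ T} λ k →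
  subst (1/8 ℚ.* √-seq n k ℚ.≤_) eq (ℚ.*-monoˡ-≤-nonNeg 1/8 (√-seq-≤ {n} {8 ℕ.* T} p k)))
  where
  eq : 1/8 ℚ.* ι (8 ℕ.* T) ≡ ι T
  eq = trans (cong (1/8 ℚ.*_) (ι-* 8 T))
    (trans (sym (ℚ.*-assoc 1/8 (ι 8) (ι T))) (ℚ.*-identityˡ (ι T)))

-- The interface between the quantum and the string side: all that is asked of `P` is a pair of
-- characters, chosen from σ alone, for which the marked position is always the correct output. The
-- factor 1/8 is the inverse of the 8 in n ≤ (8T)².
marking⇒Ω√n : (P : Problem) →
  (∀ σ → 2 ℕ.≤ σ → ∃[ c₀ ] ∃[ c₁ ] ∀ {n} (i : Fin n) → P (marked {σ = σ} c₀ c₁ i) i) →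
  Requires-Ω√n-Queries P
marking⇒Ω√n P marks k = 1/8 , 16 , ℚ.positive⁻¹ 1/8 , λ n 16≤n σ 2≤σ _ T A solves →
  let (c₀ , c₁ , correct) = marks σ 2≤σ
  in √n≤8T {n} {T} (quadratic-bound n T 16≤n (clear-denominators n T
       (success-bound A c₀ c₁ λ i → solves (marked c₀ c₁ i) i (correct i))))

-- Extremal suffixes of marked strings.

suffix-∷ : ∀ {n σ} (s : Str n σ) (j : Fin n) → ∃[ cs ] suffix s j ≡ Vec.lookup s j ∷ cs
suffix-∷ (c ∷ s) Fin.zero    = Vec.toList s , refl
suffix-∷ (c ∷ s) (Fin.suc j) = suffix-∷ s j

-- Suffixes at valid positions are nonempty, so their first characters already decide the
-- comparison, whatever their lengths.
lookup-<⇒≺ : ∀ {n σ} (s : Str n σ) (i j : Fin n) → Vec.lookup s i Fin.< Vec.lookup s j → suffix s i ≺ suffix s j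
lookup-<⇒≺ s i j lt with suffix-∷ s i | suffix-∷ s j
... | _ , p | _ , q = subst₂ _≺_ (sym p) (sym q) (this lt)

mainTheorem6 : Requires-Ω√n-Queries MaximalSuffix × Requires-Ω√n-Queries MinimalSuffix
mainTheorem6 = marking⇒Ω√n MaximalSuffix max , marking⇒Ω√n MinimalSuffix min
  where
  max : ∀ σ → 2 ℕ.≤ σ → ∃[ c₀ ] ∃[ c₁ ] ∀ {n} (i : Fin n) → MaximalSuffix (marked {σ = σ} c₀ c₁ i) i
  -- The two smallest characters exist in every alphabet with σ ≥ 2. Only the suffix at i starts
  -- with the larger one; for `min` the two exchange roles.
  max (suc (suc σ)) (ℕ.s≤s (ℕ.s≤s _)) = 0F , 1F , λ i j j≢i → lookup-<⇒≺ (marked 0F 1F i) j i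
    (subst₂ Fin._<_ (sym (lookup-marked′ 0F 1F j≢i)) (sym (lookup-marked 0F 1F i)) ℕ.z<s)
  min : ∀ σ → 2 ℕ.≤ σ → ∃[ c₀ ] ∃[ c₁ ] ∀ {n} (i : Fin n) → MinimalSuffix (marked {σ = σ} c₀ c₁ i) i
  min (suc (suc σ)) (ℕ.s≤s (ℕ.s≤s _)) = 1F , 0F , λ i j j≢i → lookup-<⇒≺ (marked 1F 0F i) i j
    (subst₂ Fin._<_ (sym (lookup-marked 1F 0F i)) (sym (lookup-marked′ 1F 0F j≢i)) ℕ.z<s)
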